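{- Let $n$ be a positive integer and let $K_n$ be the complete graph on $n$ vertices. The flow polynomial of $K_n$ satisfies $$F_{K_n}(x)=\frac{(-1)^{\frac{n(n-1)}{2}}}{x^n}\sum_{\lambda}f(\lambda)\,(1-x)^{s(\lambda)}\,x(x-1)\cdots(x-\ell(\lambda)+1),$$ where the sum is over all partitions $\lambda=(\lambda_1,\ldots,\lambda_{\ell(\lambda)})$ of the number $n$, $s(\lambda)=\sum_{i=1}^{\ell(\lambda)}\frac{\lambda_i(\lambda_i-1)}{2}$, and $f(\lambda)$ is the number of ways of dividing a set of $n$ distinct elements into (unordered) parts whose cardinalities are given by $\lambda$.
   Context: A partition $\lambda$ of $n$ is a representation of $n$ as a sum of positive integers $\lambda_1\le\lambda_2\le\dots\le\lambda_m$, the order of summands being irrelevant; $\ell(\lambda)=m$ is its length. If $n_i$ denotes the number of parts of $\lambda$ equal to $i$, then $$f(\lambda)=\frac{n!}{\prod_{i\ge1}(i!)^{n_i}\,n_i!}.$$ The flow polynomial $F_G$ of a graph $G=(V,E)$ is the polynomial such that, for every positive integer $q$, $F_G(q)$ is the number of nowhere-zero flows with values in $\mathbb{Z}_q=\mathbb{Z}/q\mathbb{Z}$: after fixing any orientation of the edges, these are the assignments of a nonzero element $k_e\in\mathbb{Z}_q$ to each edge $e$ such that at every vertex the sum of $k_e$ over incoming edges equals the sum over outgoing edges. Equivalently, $F_G$ is the characteristic polynomial $\chi_{M}(x)=\sum_{A\subseteq E}(-1)^{|A|}x^{r_M(E)-r_M(A)}$ of the dual $M=M_G^*$ of the graphic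 matroid $M_G$ of $G$. -}

module Defs where

open import Data.Bool.Base using (Bool; true; false; if_then_else_)
open import Data.Fin.Base using (Fin; toℕ)
import Data.Fin.Properties as Fin
open import Data.Fin.Subset using (Subset; Nonempty; ∣_∣)
open import Data.Fin.Subset.Properties using (_∈?_; nonempty?)
open import Data.Integer.Base as ℤ using (ℤ; +_; 0ℤ; 1ℤ)
open import Data.List.Base
  using (List; []; _∷_; _++_; allFin; cartesianProduct; cartesianProductWith;
         concatMap; filter; foldr; length; map; upTo)
import Data.List.Properties as List
open import Data.List.Relation.Unary.All as All using (All)
open import Data.List.Relation.Unary.Linked using (Linked; linked?)
open import Data.Nat.Base using (ℕ; zero; suc; _*_; _∸_; _≤_; NonZero)
open import Data.Nat.DivMod using (_/_; _%_)
open import Data.Nat.ListAction using (sum)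
open import Data.Nat.Properties using (_≟_; _≤?_; ≤-decTotalOrder)
open import Data.List.Sort.InsertionSort.Base ≤-decTotalOrder using (sort)
open import Data.Product.Base using (_×_; _,_; swap; uncurry)
open import Data.Sum.Base using (_⊎_)
open import Data.Vec.Base as Vec using (Vec; []; _∷_; fromList; toList; zipWith)
open import Data.Vec.Relation.Binary.Pointwise.Inductive using (Pointwise)
import Data.Vec.Relation.Unary.All as VecAll
open import Relation.Binary.PropositionalEquality using (_≡_; _≢_)
open import Relation.Nullary.Decidable using (Dec; does; ¬?; _×-dec_)

-- Polynomials over ℤ by coefficients, constant term first; trailing zeros
-- are allowed, so the equality of polynomials is _≈_ below rather than _≡_.

Poly : Set
Poly = List ℤ

coeff : Poly → ℕ → ℤ
coeff []      _       = 0ℤ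
coeff (a ∷ p) zero    = a
coeff (a ∷ p) (suc i) = coeff p i

infix 4 _≈_

_≈_ : Poly → Poly → Set
p ≈ q = ∀ i → coeff p i ≡ coeff q i

eval : Poly → ℤ → ℤ
eval p x = foldr (λ a r → a ℤ.+ x ℤ.* r) 0ℤ p

const : ℤ → Poly
const a = a ∷ []

X : Poly
X = 0ℤ ∷ 1ℤ ∷ []

infixl 6 _⊕_ _⊖_
infixl 7 _⊗_
infixr 8 _^ᵖ_

_⊕_ : Poly → Poly → Poly
[]      ⊕ q       = q
(a ∷ p) ⊕ []      = a ∷ p
(a ∷ p) ⊕ (b ∷ q) = (a ℤ.+ b) ∷ (p ⊕ q)

_⊖_ : Poly → Poly → Poly
p ⊖ q = p ⊕ map ℤ.-_ q

_⊗_ : Poly → Poly → Poly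
[]      ⊗ q = []
(a ∷ p) ⊗ q = map (a ℤ.*_) q ⊕ (0ℤ ∷ (p ⊗ q))

_^ᵖ_ : Poly → ℕ → Poly
p ^ᵖ zero  = const 1ℤ
p ^ᵖ suc k = p ⊗ p ^ᵖ k

sumᵖ : List Poly → Poly
sumᵖ = foldr _⊕_ []

fallingFactorial : ℕ → Poly
fallingFactorial zero    = const 1ℤ
fallingFactorial (suc k) = fallingFactorial k ⊗ (X ⊖ const (+ k))

words : {A : Set} (m : ℕ) → List A → List (Vec A m)
words zero    xs = [] ∷ []
words (suc m) xs = cartesianProductWith _∷_ xs (words m xs)

sublists : {A : Set} → List A → List (List A)
sublists []       = [] ∷ []
sublists (x ∷ xs) = map (x ∷_) (sublists xs) ++ sublists xs

-- Finite graphs; loops and parallel edges are allowed.  The order of the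
-- two ends of an edge carries no meaning.

record Graph : Set where
  field
    order : ℕ
    size  : ℕ
    edges : Vec (Fin order × Fin order) size

-- An arc (s , t) runs from s to t.

Arcs : ℕ → ℕ → Set
Arcs n m = Vec (Fin n × Fin n) m

Orients : (G : Graph) → let open Graph G in Arcs order size → Set
Orients G arcs = Pointwise (λ a e → a ≡ e ⊎ a ≡ swap e) arcs (Graph.edges G)

module _ {n m q : ℕ} where

  inflow : Fin n → Arcs n m → Vec (Fin q) m → ℕ
  inflow v arcs k =
    Vec.sum (zipWith (λ (s , t) kₑ → if does (t Fin.≟ v) then toℕ kₑ else 0) arcs k)

  outflow : Fin n → Arcs n m → Vec (Fin q) m → ℕ
  outflow v arcs k =
    Vec.sum (zipWith (λ (s , t) kₑ → if does (s Fin.≟ v) then toℕ kₑ else 0) arcs k)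

  NowhereZero : Vec (Fin q) m → Set
  NowhereZero = VecAll.All (λ kₑ → toℕ kₑ ≢ 0)

  -- Fin q holds the residues modulo q, so equality in ℤ/qℤ of the sums of
  -- values is congruence modulo q of the sums of representatives.

  Conserved : .{{_ : NonZero q}} → Arcs n m → Vec (Fin q) m → Set
  Conserved arcs k = ∀ v → inflow v arcs k % q ≡ outflow v arcs k % q

  IsNowhereZeroFlow : .{{_ : NonZero q}} → Arcs n m → Vec (Fin q) m → Set
  IsNowhereZeroFlow arcs k = NowhereZero k × Conserved arcs k

  isNowhereZeroFlow? : .{{_ : NonZero q}} (arcs : Arcs n m) (k : Vec (Fin q) m) →
                       Dec (IsNowhereZeroFlow arcs k)
  isNowhereZeroFlow? arcs k =
    VecAll.all? (λ kₑ → ¬? (toℕ kₑ ≟ 0)) k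
      ×-dec
    Fin.all? (λ v → inflow v arcs k % q ≟ outflow v arcs k % q)

flowCount : {n m : ℕ} → Arcs n m → (q : ℕ) → .{{_ : NonZero q}} → ℕ
flowCount {m = m} arcs q = length (filter (isNowhereZeroFlow? arcs) (words m (allFin q)))

IsFlowPolynomial : Graph → Poly → Set
IsFlowPolynomial G F =
  ∀ arcs → Orients G arcs →
  ∀ q → .{{_ : NonZero q}} → eval F (+ q) ≡ + flowCount arcs q

K : ℕ → Graph
K n = record
  { edges = fromList (filter (uncurry Fin._<?_) (cartesianProduct (allFin n) (allFin n))) }

IsPartition : ℕ → List ℕ → Set
IsPartition n μ = Linked _≤_ μ × All (1 ≤_) μ × sum μ ≡ n

isPartition? : (n : ℕ) (μ : List ℕ) → Dec (IsPartition n μ)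
isPartition? n μ = linked? _≤?_ μ ×-dec All.all? (1 ≤?_) μ ×-dec (sum μ ≟ n)

-- A partition of n has at most n parts, none exceeding n.

partitions : ℕ → List (List ℕ)
partitions n =
  filter (isPartition? n)
    (concatMap (λ m → map toList (words m (upTo (suc n)))) (upTo (suc n)))

s : List ℕ → ℕ
s μ = sum (map (λ k → (k * (k ∸ 1)) / 2) μ)

IsDivision : {n : ℕ} → List (Subset n) → Set
IsDivision π = All Nonempty π × (∀ i → length (filter (i ∈?_) π) ≡ 1)

isDivision? : {n : ℕ} (π : List (Subset n)) → Dec (IsDivision π)
isDivision? π = All.all? nonempty? π ×-dec Fin.all? (λ i → length (filter (i ∈?_) π) ≟ 1)

-- Each subset of Fin n occurs exactly once in the list of all words over
-- Bool, so the sublists of that list are the unordered families of distinct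
-- subsets, each once.

divisions : (n : ℕ) → List (List (Subset n))
divisions n = filter isDivision? (sublists (words n (true ∷ false ∷ [])))

f : (n : ℕ) → List ℕ → ℕ
f n μ = length (filter (λ π → List.≡-dec _≟_ (sort (map ∣_∣ π)) μ) (divisions n))

module Submission where

-- Deleting and contracting edges, with contraction keeping the vertex set and
-- moving the ends at t to s, gives by induction
--   qⁿ · #flows = Σ_c ∏_{uv} (q [c u = c v] − 1),
-- the sum being over all colourings c of the vertices by q colours.  The right
-- side does not depend on the orientation; for K n it is (−1)^(n(n−1)/2) times
-- Σ_c (1−q)^(number of monochromatic pairs).  A colouring is a q-tuple of
-- disjoint, possibly empty, colour classes covering the vertices.  Adding one
-- colour adds one class, which on the side of set partitions is the recurrence
-- (1+x)_k = (x)_k + k (x)_{k−1} with one marked block; so the sum over colourings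
-- is Σ_π (1−q)^s(π) (q)_|π| over set partitions π, and it remains to group them
-- by block sizes.  Polynomials over ℤ that agree at all positive integers have
-- the same coefficients.

open import Defs
open import Data.Bool.Base using (Bool; true; false; if_then_else_)
open import Data.Fin.Base using (Fin; zero; suc; toℕ; fromℕ<)
import Data.Fin.Properties as Fin
open import Data.Fin.Subset using (Subset; Nonempty; ∣_∣; ⊥; ⁅_⁆; _∈_; _∉_; inside; outside)
open import Data.Fin.Subset.Properties using (_∈?_; nonempty?; ∉⊥; ∣⊥∣≡0; x∈p⇒∣p-x∣<∣p∣)
open import Data.Integer.Base as ℤ using (ℤ; +_; -1ℤ; 0ℤ; 1ℤ; _^_)
import Data.Integer.Properties as ℤ
open import Data.Integer.Tactic.RingSolver using (solve-∀)
open import Data.List.Base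
  using (List; []; _∷_; _++_; allFin; applyUpTo; cartesianProduct;
         cartesianProductWith; concatMap; filter; length; map; tabulate; upTo)
open import Data.List.Membership.Propositional using () renaming (_∈_ to _∈ˡ_)
open import Data.List.Membership.Propositional.Properties using (∈-filter⁺; ∈-length)
open import Data.List.Properties using (length-map; length-tabulate; ≡-dec; ∷-injective)
open import Data.List.Relation.Binary.Permutation.Propositional
  using (_↭_; prep; ↭-refl; ↭-sym; ↭-trans)
  renaming (swap to ↭-swap)
open import Data.List.Relation.Binary.Permutation.Propositional.Properties
  using (↭-length; filter-↭; All-resp-↭)
  renaming (map⁺ to ↭-map⁺)
open import Data.List.Relation.Unary.All as All using (All; []; _∷_)
import Data.List.Relation.Unary.All.Properties as All
open import Data.List.Relation.Unary.Any using (here; there)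
open import Data.Nat.Base as ℕ using (ℕ; zero; suc; NonZero; _*_; _∸_)
open import Data.Nat.Divisibility using (divides)
open import Data.Nat.DivMod
  using (_/_; _%_; %-distribˡ-+; [m+kn]%n≡m%n; m%n%n≡m%n; m%n<n; m<n⇒m%n≡m;
         +-distrib-/-∣ˡ; m*n/n≡m)
open import Data.Nat.ListAction using (sum)
open import Data.Nat.ListAction.Properties using (sum-↭)
import Data.Nat.Properties as ℕ
import Data.Nat.Tactic.RingSolver as ℕSolver
open import Data.List.Sort.Base ℕ.≤-totalOrder using (module SortingAlgorithm)
open import Data.List.Sort.InsertionSort ℕ.≤-decTotalOrder using (sort; insertionSort)
open import Data.Product.Base using (_×_; _,_; ∃; proj₁; proj₂; swap; uncurry)
open import Data.Sum.Base using (_⊎_; inj₁; inj₂)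
open import Data.Vec.Base as Vec using (Vec; []; _∷_; lookup; toList; zipWith; _[_]≔_)
open import Data.Vec.Properties
  using (lookup-replicate; lookup-zipWith; lookup∘update; lookup∘update′)
open import Data.Vec.Relation.Binary.Pointwise.Inductive as Pointwise
  using (Pointwise; []; _∷_)
import Data.Vec.Relation.Unary.All as VecAll
open import Function.Base using (_∘_; id)
open import Relation.Binary.PropositionalEquality
  using (_≡_; _≢_; refl; sym; trans; cong; cong₂; module ≡-Reasoning)
open import Relation.Nullary.Decidable using (Dec; does; yes; no; _×-dec_; ¬?)
open import Relation.Nullary.Negation using (¬_; contradiction)
open import Relation.Unary using (Decidable)

open SortingAlgorithm insertionSort using (sort-↭; sort-↗)

-- The weight of an edge comes from characters. For a primitive q-th root of unity ζ, q [c u = c v]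
-- - 1 is the sum of ζ^(a (c u - c v)) over the nonzero residues a, and summing the product of these
-- over all colourings c keeps exactly the conserved assignments, each with the factor qⁿ. Deletion
-- and contraction prove the same identity inside ℤ. The identity also yields independence of the
-- orientation, because qⁿ is nonzero and can be cancelled.
--
-- Passing from tuples of classes to set partitions is an induction on q that removes one class at a
-- time, so what remains has to cover a smaller set. Both sums therefore carry a list σ of the
-- blocks removed so far. A tuple may repeat the empty class, whereas a family consists of distinct
-- nonempty blocks; the empty class is accounted for in the step from x to 1 + x. The induction
-- starts at x = 0, where only the empty family survives.

private
  variable
    A B : Set
    P Q : Set
    m n q : ℕ

-- Finite sums

∑ : List A → (A → ℤ) → ℤ
∑ []       g = 0ℤ
∑ (x ∷ xs) g = g x ℤ.+ ∑ xs g

∑-congᴬ : {xs : List A} {g h : A → ℤ} → All (λ x → g x ≡ h x) xs → ∑ xs g ≡ ∑ xs h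
∑-congᴬ []       = refl
∑-congᴬ (e ∷ es) = cong₂ ℤ._+_ e (∑-congᴬ es)

∑-cong : (xs : List A) {g h : A → ℤ} → (∀ x → g x ≡ h x) → ∑ xs g ≡ ∑ xs h
∑-cong xs e = ∑-congᴬ (All.universal e xs)

∑-++ : (xs ys : List A) (g : A → ℤ) → ∑ (xs ++ ys) g ≡ ∑ xs g ℤ.+ ∑ ys g
∑-++ []       ys g = sym (ℤ.+-identityˡ _)
∑-++ (x ∷ xs) ys g = trans (cong (ℤ._+_ (g x)) (∑-++ xs ys g)) (sym (ℤ.+-assoc (g x) _ _))

∑-map : (h : A → B) (xs : List A) (g : B → ℤ) → ∑ (map h xs) g ≡ ∑ xs (g ∘ h)
∑-map h []       g = refl
∑-map h (x ∷ xs) g = cong (ℤ._+_ (g (h x))) (∑-map h xs g)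

∑-concatMap : (h : A → List B) (xs : List A) (g : B → ℤ) →
              ∑ (concatMap h xs) g ≡ ∑ xs (λ x → ∑ (h x) g)
∑-concatMap h []       g = refl
∑-concatMap h (x ∷ xs) g =
  trans (∑-++ (h x) (concatMap h xs) g) (cong (ℤ._+_ (∑ (h x) g)) (∑-concatMap h xs g))

∑-cartesianProductWith : {C : Set} (h : A → B → C) (xs : List A) (ys : List B) (g : C → ℤ) →
  ∑ (cartesianProductWith h xs ys) g ≡ ∑ xs (λ x → ∑ ys (λ y → g (h x y)))
∑-cartesianProductWith h []       ys g = refl
∑-cartesianProductWith h (x ∷ xs) ys g =
  trans (∑-++ (map (h x) ys) _ g)
        (cong₂ ℤ._+_ (∑-map (h x) ys g) (∑-cartesianProductWith h xs ys g))

∑-words-suc : (m : ℕ) (xs : List A) (g : Vec A (suc m) → ℤ) →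
  ∑ (words (suc m) xs) g ≡ ∑ xs (λ x → ∑ (words m xs) (λ w → g (x ∷ w)))
∑-words-suc m xs g = ∑-cartesianProductWith _∷_ xs (words m xs) g

∑-0 : (xs : List A) → ∑ xs (λ _ → 0ℤ) ≡ 0ℤ
∑-0 []       = refl
∑-0 (x ∷ xs) = trans (ℤ.+-identityˡ _) (∑-0 xs)

∑-+ : (xs : List A) (g h : A → ℤ) → ∑ xs (λ x → g x ℤ.+ h x) ≡ ∑ xs g ℤ.+ ∑ xs h
∑-+ []       g h = refl
∑-+ (x ∷ xs) g h =
  trans (cong (ℤ._+_ (g x ℤ.+ h x)) (∑-+ xs g h)) (interchange (g x) (h x) (∑ xs g) (∑ xs h))
  where
  interchange : ∀ a b c d → a ℤ.+ b ℤ.+ (c ℤ.+ d) ≡ a ℤ.+ c ℤ.+ (b ℤ.+ d)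
  interchange = solve-∀

∑-*ˡ : (xs : List A) (a : ℤ) (g : A → ℤ) → ∑ xs (λ x → a ℤ.* g x) ≡ a ℤ.* ∑ xs g
∑-*ˡ []       a g = sym (ℤ.*-zeroʳ a)
∑-*ˡ (x ∷ xs) a g =
  trans (cong (ℤ._+_ (a ℤ.* g x)) (∑-*ˡ xs a g)) (sym (ℤ.*-distribˡ-+ a (g x) _))

∑-*ʳ : (xs : List A) (a : ℤ) (g : A → ℤ) → ∑ xs (λ x → g x ℤ.* a) ≡ ∑ xs g ℤ.* a
∑-*ʳ xs a g =
  trans (∑-cong xs (λ x → ℤ.*-comm (g x) a)) (trans (∑-*ˡ xs a g) (ℤ.*-comm a _))

∑-- : (xs : List A) (g h : A → ℤ) → ∑ xs (λ x → g x ℤ.- h x) ≡ ∑ xs g ℤ.- ∑ xs h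
∑-- []       g h = refl
∑-- (x ∷ xs) g h =
  trans (cong (ℤ._+_ (g x ℤ.- h x)) (∑-- xs g h)) (interchange (g x) (h x) (∑ xs g) (∑ xs h))
  where
  interchange : ∀ a b c d → a ℤ.- b ℤ.+ (c ℤ.- d) ≡ a ℤ.+ c ℤ.- (b ℤ.+ d)
  interchange = solve-∀

∑-const : (xs : List A) (a : ℤ) → ∑ xs (λ _ → a) ≡ + length xs ℤ.* a
∑-const []       a = refl
∑-const (x ∷ xs) a = trans (cong (ℤ._+_ a) (∑-const xs a)) (sym (ℤ.suc-* (+ length xs) a))

∑-swap : (xs : List A) (ys : List B) (g : A → B → ℤ) →
         ∑ xs (λ x → ∑ ys (g x)) ≡ ∑ ys (λ y → ∑ xs (λ x → g x y))
∑-swap []       ys g = sym (∑-0 ys)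
∑-swap (x ∷ xs) ys g =
  trans (cong (ℤ._+_ (∑ ys (g x))) (∑-swap xs ys g)) (sym (∑-+ ys (g x) _))

∑-tabulate : ∀ {n} (h : Fin n → A) (g : A → ℤ) → ∑ (tabulate h) g ≡ ∑ (allFin n) (g ∘ h)
∑-tabulate {n = zero}  h g = refl
∑-tabulate {n = suc n} h g =
  cong (ℤ._+_ (g (h zero)))
       (trans (∑-tabulate (h ∘ suc) g) (sym (∑-tabulate suc (g ∘ h))))

∑-allFin-suc : ∀ n (g : Fin (suc n) → ℤ) →
  ∑ (allFin (suc n)) g ≡ g zero ℤ.+ ∑ (allFin n) (g ∘ suc)
∑-allFin-suc n g = cong (ℤ._+_ (g zero)) (∑-tabulate suc g)

∑-allFin-const : ∀ n a → ∑ (allFin n) (λ _ → a) ≡ + n ℤ.* a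
∑-allFin-const n a =
  trans (∑-const (allFin n) a) (cong (λ k → + k ℤ.* a) (length-tabulate {n = n} id))

-- Indicators of decidable propositions

𝟙 : Dec P → ℤ
𝟙 d = if does d then 1ℤ else 0ℤ

𝟙-yes : (d : Dec P) → P → 𝟙 d ≡ 1ℤ
𝟙-yes (yes _) _ = refl
𝟙-yes (no ¬p) p = contradiction p ¬p

𝟙-no : (d : Dec P) → ¬ P → 𝟙 d ≡ 0ℤ
𝟙-no (yes p) ¬p = contradiction p ¬p
𝟙-no (no _)  _  = refl

𝟙-cong : (d : Dec P) (e : Dec Q) → (P → Q) → (Q → P) → 𝟙 d ≡ 𝟙 e
𝟙-cong (yes p) e to from = sym (𝟙-yes e (to p))
𝟙-cong (no ¬p) e to from = sym (𝟙-no e (¬p ∘ from))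

𝟙-× : (d : Dec P) (e : Dec Q) → 𝟙 (d ×-dec e) ≡ 𝟙 d ℤ.* 𝟙 e
𝟙-× (yes _) e = sym (ℤ.*-identityˡ _)
𝟙-× (no _)  e = refl

∑-filter : {P : A → Set} (P? : Decidable P) (xs : List A) (g : A → ℤ) →
           ∑ (filter P? xs) g ≡ ∑ xs (λ x → 𝟙 (P? x) ℤ.* g x)
∑-filter P? []       g = refl
∑-filter P? (x ∷ xs) g with P? x
... | yes _ = cong₂ ℤ._+_ (sym (ℤ.*-identityˡ (g x))) (∑-filter P? xs g)
... | no  _ = trans (∑-filter P? xs g) (sym (ℤ.+-identityˡ _))

length-filter-∑ : {P : A → Set} (P? : Decidable P) (xs : List A) →
                  + length (filter P? xs) ≡ ∑ xs (λ x → 𝟙 (P? x))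
length-filter-∑ P? xs = begin
  + length (filter P? xs)               ≡⟨ ℤ.*-identityʳ _ ⟨
  + length (filter P? xs) ℤ.* 1ℤ        ≡⟨ ∑-const (filter P? xs) 1ℤ ⟨
  ∑ (filter P? xs) (λ _ → 1ℤ)           ≡⟨ ∑-filter P? xs _ ⟩
  ∑ xs (λ x → 𝟙 (P? x) ℤ.* 1ℤ)          ≡⟨ ∑-cong xs (λ x → ℤ.*-identityʳ _) ⟩
  ∑ xs (λ x → 𝟙 (P? x))                 ∎
  where open ≡-Reasoning

∑-δ : ∀ {n} (b : Fin n) (g : Fin n → ℤ) → ∑ (allFin n) (λ a → 𝟙 (a Fin.≟ b) ℤ.* g a) ≡ g b
∑-δ {suc n} zero g = begin
  ∑ (allFin (suc n)) (λ a → 𝟙 (a Fin.≟ zero) ℤ.* g a)  ≡⟨ ∑-allFin-suc n (λ a → 𝟙 (a Fin.≟ zero) ℤ.* g a) ⟩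
  1ℤ ℤ.* g zero ℤ.+ ∑ (allFin n) (λ _ → 0ℤ)             ≡⟨ cong₂ ℤ._+_ (ℤ.*-identityˡ (g zero)) (∑-0 (allFin n)) ⟩
  g zero ℤ.+ 0ℤ                                         ≡⟨ ℤ.+-identityʳ _ ⟩
  g zero                                                ∎
  where open ≡-Reasoning
∑-δ {suc n} (suc b) g = begin
  ∑ (allFin (suc n)) (λ a → 𝟙 (a Fin.≟ suc b) ℤ.* g a)
    ≡⟨ ∑-allFin-suc n (λ a → 𝟙 (a Fin.≟ suc b) ℤ.* g a) ⟩
  0ℤ ℤ.+ ∑ (allFin n) (λ a → 𝟙 (suc a Fin.≟ suc b) ℤ.* g (suc a))   ≡⟨ ℤ.+-identityˡ _ ⟩
  ∑ (allFin n) (λ a → 𝟙 (suc a Fin.≟ suc b) ℤ.* g (suc a))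
    ≡⟨ ∑-cong (allFin n) (λ a → cong (ℤ._* g (suc a)) (𝟙-cong (suc a Fin.≟ suc b) (a Fin.≟ b) Fin.suc-injective (cong suc))) ⟩
  ∑ (allFin n) (λ a → 𝟙 (a Fin.≟ b) ℤ.* g (suc a))                  ≡⟨ ∑-δ b (g ∘ suc) ⟩
  g (suc b)                                                        ∎
  where open ≡-Reasoning

-- Conservation under contraction

%-+-cong : ∀ a b c d q .{{_ : NonZero q}} → a % q ≡ b % q → c % q ≡ d % q → (a ℕ.+ c) % q ≡ (b ℕ.+ d) % q
%-+-cong a b c d q e₁ e₂ = begin
  (a ℕ.+ c) % q            ≡⟨ %-distribˡ-+ a c q ⟩
  (a % q ℕ.+ c % q) % q    ≡⟨ cong₂ (λ x y → (x ℕ.+ y) % q) e₁ e₂ ⟩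
  (b % q ℕ.+ d % q) % q    ≡⟨ %-distribˡ-+ b d q ⟨
  (b ℕ.+ d) % q            ∎
  where open ≡-Reasoning

-- Modulo `suc r` the number `r` stands for -1, so adding `r * a` subtracts `a` without leaving ℕ.
%-+-cancelˡ : ∀ a c d q .{{_ : NonZero q}} → (a ℕ.+ c) % q ≡ (a ℕ.+ d) % q → c % q ≡ d % q
%-+-cancelˡ a c d q@(suc r) e =
  trans (sym (shift c)) (trans (%-+-cong (r * a) (r * a) (a ℕ.+ c) (a ℕ.+ d) q refl e) (shift d))
  where
  shift : ∀ x → (r * a ℕ.+ (a ℕ.+ x)) % q ≡ x % q
  shift x = trans (cong (_% q) (lemma r a x)) ([m+kn]%n≡m%n x a q)
    where
    lemma : ∀ r a x → r * a ℕ.+ (a ℕ.+ x) ≡ x ℕ.+ a * suc r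
    lemma = ℕSolver.solve-∀

toℕ-%-injective : ∀ {r} (a b : Fin (suc r)) → toℕ a % suc r ≡ toℕ b % suc r → a ≡ b
toℕ-%-injective a b e = Fin.toℕ-injective
  (trans (sym (m<n⇒m%n≡m (Fin.toℕ<n a))) (trans e (m<n⇒m%n≡m (Fin.toℕ<n b))))

δ : Fin n → Fin n → ℕ → ℕ
δ u v x = if does (u Fin.≟ v) then x else 0

-- `inflow` is `load proj₂` and `outflow` is `load proj₁` by definition, so each lemma on
-- contraction below is proved once and used for both ends.
load : (Fin n × Fin n → Fin n) → Fin n → Arcs n m → Vec (Fin q) m → ℕ
load end v arcs k = Vec.sum (zipWith (λ e kₑ → δ (end e) v (toℕ kₑ)) arcs k)

-- With `nowhereZero?`, one of the two factors of `isNowhereZeroFlow?`; separated so that the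
-- indicator of a flow is a product.
conserved? : .{{_ : NonZero q}} (arcs : Arcs n m) (k : Vec (Fin q) m) → Dec (Conserved arcs k)
conserved? {q = q} arcs k = Fin.all? (λ v → inflow v arcs k % q ℕ.≟ outflow v arcs k % q)

nowhereZero? : (k : Vec (Fin q) m) → Dec (NowhereZero {n} k)
nowhereZero? = VecAll.all? (λ kₑ → ¬? (toℕ kₑ ℕ.≟ 0))

merge : Fin n → Fin n → Fin n → Fin n
merge s t u = if does (u Fin.≟ t) then s else u

contract : Fin n → Fin n → Arcs n m → Arcs n m
contract s t = Vec.map (λ (u , v) → merge s t u , merge s t v)

δ-refl : (v : Fin n) (x : ℕ) → δ v v x ≡ x
δ-refl v x with v Fin.≟ v
... | yes _  = refl
... | no v≢v = contradiction refl v≢v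

δ-≢ : {u v : Fin n} → u ≢ v → (x : ℕ) → δ u v x ≡ 0
δ-≢ {u = u} {v} u≢v x with u Fin.≟ v
... | yes u≡v = contradiction u≡v u≢v
... | no _    = refl

δ-0 : (u v : Fin n) → δ u v 0 ≡ 0
δ-0 u v with does (u Fin.≟ v)
... | true  = refl
... | false = refl

module _ {s t : Fin n} (s≢t : s ≢ t) where

  δ-merge-s : ∀ u x → δ (merge s t u) s x ≡ δ u s x ℕ.+ δ u t x
  δ-merge-s u x with u Fin.≟ t
  ... | yes refl = trans (δ-refl s x) (cong (ℕ._+ x) (sym (δ-≢ (s≢t ∘ sym) x)))
  ... | no _     = sym (ℕ.+-identityʳ _)

  δ-merge-t : ∀ u x → δ (merge s t u) t x ≡ 0
  δ-merge-t u x with u Fin.≟ t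
  ... | yes _  = δ-≢ s≢t x
  ... | no u≢t = δ-≢ u≢t x

  δ-merge-other : ∀ {v} → v ≢ s → v ≢ t → ∀ u x → δ (merge s t u) v x ≡ δ u v x
  δ-merge-other v≢s v≢t u x with u Fin.≟ t
  ... | yes refl = trans (δ-≢ (v≢s ∘ sym) x) (sym (δ-≢ (v≢t ∘ sym) x))
  ... | no _     = refl

  module _ (end : Fin n × Fin n → Fin n)
           (natural : ∀ e → end (merge s t (proj₁ e) , merge s t (proj₂ e)) ≡ merge s t (end e)) where

    load-contract-s : (arcs : Arcs n m) (k : Vec (Fin q) m) →
      load end s (contract s t arcs) k ≡ load end s arcs k ℕ.+ load end t arcs k
    load-contract-s []         []       = refl
    load-contract-s (e ∷ arcs) (a ∷ k) rewrite natural e | δ-merge-s (end e) (toℕ a) | load-contract-s arcs k =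
      interchange (δ (end e) s (toℕ a)) (δ (end e) t (toℕ a)) (load end s arcs k) (load end t arcs k)
      where
      interchange : ∀ a b c d → a ℕ.+ b ℕ.+ (c ℕ.+ d) ≡ a ℕ.+ c ℕ.+ (b ℕ.+ d)
      interchange = ℕSolver.solve-∀

    load-contract-t : (arcs : Arcs n m) (k : Vec (Fin q) m) → load end t (contract s t arcs) k ≡ 0
    load-contract-t []         []       = refl
    load-contract-t (e ∷ arcs) (a ∷ k) rewrite natural e | δ-merge-t (end e) (toℕ a) = load-contract-t arcs k

    load-contract-other : ∀ {v} → v ≢ s → v ≢ t → (arcs : Arcs n m) (k : Vec (Fin q) m) →
      load end v (contract s t arcs) k ≡ load end v arcs k
    load-contract-other v≢s v≢t []         []       = refl
    load-contract-other v≢s v≢t (e ∷ arcs) (a ∷ k)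
      rewrite natural e | δ-merge-other v≢s v≢t (end e) (toℕ a) =
      cong (ℕ._+_ (δ (end e) _ (toℕ a))) (load-contract-other v≢s v≢t arcs k)

module _ {r : ℕ} where

  private
    p : ℕ
    p = suc r

  module _ {s t : Fin n} (s≢t : s ≢ t) (arcs : Arcs n m) (k : Vec (Fin p) m) where

    private
      in-s  = inflow s arcs k
      in-t  = inflow t arcs k
      out-s = outflow s arcs k
      out-t = outflow t arcs k

    -- The value on st that restores conservation at t: out − in, with −1 represented by r.

    balancing : Fin p
    balancing = fromℕ< (m%n<n (out-t ℕ.+ r * in-t) p)

    balancing-% : (toℕ balancing ℕ.+ in-t) % p ≡ out-t % p
    balancing-% = begin
      (toℕ balancing ℕ.+ in-t) % p                 ≡⟨ %-+-cong (toℕ balancing) (out-t ℕ.+ r * in-t) in-t in-t p eq refl ⟩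
      (out-t ℕ.+ r * in-t ℕ.+ in-t) % p            ≡⟨ cong (_% p) (lemma out-t in-t r) ⟩
      (out-t ℕ.+ in-t * p) % p                     ≡⟨ [m+kn]%n≡m%n out-t in-t p ⟩
      out-t % p                                    ∎
      where
      open ≡-Reasoning
      eq : toℕ balancing % p ≡ (out-t ℕ.+ r * in-t) % p
      eq = trans (cong (_% p) (Fin.toℕ-fromℕ< (m%n<n (out-t ℕ.+ r * in-t) p)))
                 (m%n%n≡m%n (out-t ℕ.+ r * in-t) p)
      lemma : ∀ o i r → o ℕ.+ r * i ℕ.+ i ≡ o ℕ.+ i * suc r
      lemma = ℕSolver.solve-∀

    -- Conservation at `t` alone determines `a`. Adding the equations at `s` and `t` eliminates `a`
    -- and leaves conservation at the merged vertex; no other vertex meets the arc from `s` to `t`.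
    conserved-extend⇒ : ∀ a → Conserved ((s , t) ∷ arcs) (a ∷ k) →
                        a ≡ balancing × Conserved (contract s t arcs) k
    conserved-extend⇒ a cons = a≡ , contracted
      where
      open ≡-Reasoning

      at-t : (toℕ a ℕ.+ in-t) % p ≡ out-t % p
      at-t with cons t
      ... | e rewrite δ-refl t (toℕ a) | δ-≢ s≢t (toℕ a) = e

      at-s : in-s % p ≡ (toℕ a ℕ.+ out-s) % p
      at-s with cons s
      ... | e rewrite δ-refl s (toℕ a) | δ-≢ (s≢t ∘ sym) (toℕ a) = e

      at-other : ∀ {v} → v ≢ s → v ≢ t → inflow v arcs k % p ≡ outflow v arcs k % p
      at-other {v} v≢s v≢t with cons v
      ... | e rewrite δ-≢ (v≢s ∘ sym) (toℕ a) | δ-≢ (v≢t ∘ sym) (toℕ a) = e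

      a≡ : a ≡ balancing
      a≡ = toℕ-%-injective a balancing (%-+-cancelˡ in-t (toℕ a) (toℕ balancing) p (begin
        (in-t ℕ.+ toℕ a) % p           ≡⟨ cong (_% p) (ℕ.+-comm in-t (toℕ a)) ⟩
        (toℕ a ℕ.+ in-t) % p           ≡⟨ at-t ⟩
        out-t % p                      ≡⟨ balancing-% ⟨
        (toℕ balancing ℕ.+ in-t) % p   ≡⟨ cong (_% p) (ℕ.+-comm (toℕ balancing) in-t) ⟩
        (in-t ℕ.+ toℕ balancing) % p   ∎))

      merged : (in-s ℕ.+ in-t) % p ≡ (out-s ℕ.+ out-t) % p
      merged = begin
        (in-s ℕ.+ in-t) % p                    ≡⟨ %-+-cong in-s (toℕ a ℕ.+ out-s) in-t in-t p at-s refl ⟩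
        (toℕ a ℕ.+ out-s ℕ.+ in-t) % p         ≡⟨ cong (_% p) (rotate (toℕ a) out-s in-t) ⟩
        (out-s ℕ.+ (toℕ a ℕ.+ in-t)) % p       ≡⟨ %-+-cong out-s out-s (toℕ a ℕ.+ in-t) out-t p refl at-t ⟩
        (out-s ℕ.+ out-t) % p                  ∎
        where
        rotate : ∀ a o i → a ℕ.+ o ℕ.+ i ≡ o ℕ.+ (a ℕ.+ i)
        rotate = ℕSolver.solve-∀

      contracted : Conserved (contract s t arcs) k
      contracted v with v Fin.≟ s | v Fin.≟ t
      ... | yes refl | _ = begin
        inflow s (contract s t arcs) k % p    ≡⟨ cong (_% p) (load-contract-s s≢t proj₂ (λ _ → refl) arcs k) ⟩
        (in-s ℕ.+ in-t) % p                   ≡⟨ merged ⟩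
        (out-s ℕ.+ out-t) % p                 ≡⟨ cong (_% p) (load-contract-s s≢t proj₁ (λ _ → refl) arcs k) ⟨
        outflow s (contract s t arcs) k % p   ∎
      ... | no _ | yes refl = cong (_% p) (trans (load-contract-t s≢t proj₂ (λ _ → refl) arcs k)
                                                 (sym (load-contract-t s≢t proj₁ (λ _ → refl) arcs k)))
      ... | no v≢s | no v≢t = begin
        inflow v (contract s t arcs) k % p    ≡⟨ cong (_% p) (load-contract-other s≢t proj₂ (λ _ → refl) v≢s v≢t arcs k) ⟩
        inflow v arcs k % p                   ≡⟨ at-other v≢s v≢t ⟩
        outflow v arcs k % p                  ≡⟨ cong (_% p) (load-contract-other s≢t proj₁ (λ _ → refl) v≢s v≢t arcs k) ⟨
        outflow v (contract s t arcs) k % p   ∎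

    -- At `t` the choice of `balancing` is enough. At `s` the equation of the merged vertex is used,
    -- from which the equation at `t` is subtracted by cancelling `in-t`.
    conserved-extend⇐ : ∀ a → a ≡ balancing × Conserved (contract s t arcs) k →
                        Conserved ((s , t) ∷ arcs) (a ∷ k)
    conserved-extend⇐ a (refl , contracted) v with v Fin.≟ s | v Fin.≟ t
    ... | yes refl | _ rewrite δ-refl s (toℕ a) | δ-≢ (s≢t ∘ sym) (toℕ a) =
      %-+-cancelˡ in-t in-s (toℕ a ℕ.+ out-s) p (begin
        (in-t ℕ.+ in-s) % p                        ≡⟨ cong (_% p) (ℕ.+-comm in-t in-s) ⟩
        (in-s ℕ.+ in-t) % p                        ≡⟨ cong (_% p) (load-contract-s s≢t proj₂ (λ _ → refl) arcs k) ⟨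
        inflow s (contract s t arcs) k % p         ≡⟨ contracted s ⟩
        outflow s (contract s t arcs) k % p        ≡⟨ cong (_% p) (load-contract-s s≢t proj₁ (λ _ → refl) arcs k) ⟩
        (out-s ℕ.+ out-t) % p                      ≡⟨ %-+-cong out-s out-s (toℕ balancing ℕ.+ in-t) out-t p refl balancing-% ⟨
        (out-s ℕ.+ (toℕ a ℕ.+ in-t)) % p           ≡⟨ cong (_% p) (rotate out-s (toℕ a) in-t) ⟩
        (in-t ℕ.+ (toℕ a ℕ.+ out-s)) % p           ∎)
      where
      open ≡-Reasoning
      rotate : ∀ o a i → o ℕ.+ (a ℕ.+ i) ≡ i ℕ.+ (a ℕ.+ o)
      rotate = ℕSolver.solve-∀
    ... | no _ | yes refl rewrite δ-refl t (toℕ a) | δ-≢ s≢t (toℕ a) = balancing-%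
    ... | no v≢s | no v≢t rewrite δ-≢ (v≢s ∘ sym) (toℕ a) | δ-≢ (v≢t ∘ sym) (toℕ a) = begin
        inflow v arcs k % p                   ≡⟨ cong (_% p) (load-contract-other s≢t proj₂ (λ _ → refl) v≢s v≢t arcs k) ⟨
        inflow v (contract s t arcs) k % p    ≡⟨ contracted v ⟩
        outflow v (contract s t arcs) k % p   ≡⟨ cong (_% p) (load-contract-other s≢t proj₁ (λ _ → refl) v≢s v≢t arcs k) ⟩
        outflow v arcs k % p                  ∎
      where open ≡-Reasoning

-- Polynomials and their values

eval-⊕ : ∀ p q x → eval (p ⊕ q) x ≡ eval p x ℤ.+ eval q x
eval-⊕ []      q       x = sym (ℤ.+-identityˡ _)
eval-⊕ (a ∷ p) []      x = sym (ℤ.+-identityʳ _)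
eval-⊕ (a ∷ p) (b ∷ q) x rewrite eval-⊕ p q x = lemma a b x (eval p x) (eval q x)
  where
  lemma : ∀ a b x u v → a ℤ.+ b ℤ.+ x ℤ.* (u ℤ.+ v) ≡ a ℤ.+ x ℤ.* u ℤ.+ (b ℤ.+ x ℤ.* v)
  lemma = solve-∀

eval-scale : ∀ c p x → eval (map (c ℤ.*_) p) x ≡ c ℤ.* eval p x
eval-scale c []      x = sym (ℤ.*-zeroʳ c)
eval-scale c (a ∷ p) x rewrite eval-scale c p x = lemma c a x (eval p x)
  where
  lemma : ∀ c a x u → c ℤ.* a ℤ.+ x ℤ.* (c ℤ.* u) ≡ c ℤ.* (a ℤ.+ x ℤ.* u)
  lemma = solve-∀

eval-neg : ∀ p x → eval (map ℤ.-_ p) x ≡ ℤ.- eval p x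
eval-neg []      x = refl
eval-neg (a ∷ p) x rewrite eval-neg p x = lemma a x (eval p x)
  where
  lemma : ∀ a x u → ℤ.- a ℤ.+ x ℤ.* (ℤ.- u) ≡ ℤ.- (a ℤ.+ x ℤ.* u)
  lemma = solve-∀

eval-⊖ : ∀ p q x → eval (p ⊖ q) x ≡ eval p x ℤ.- eval q x
eval-⊖ p q x = trans (eval-⊕ p (map ℤ.-_ q) x) (cong (ℤ._+_ (eval p x)) (eval-neg q x))

eval-⊗ : ∀ p q x → eval (p ⊗ q) x ≡ eval p x ℤ.* eval q x
eval-⊗ []      q x = refl
eval-⊗ (a ∷ p) q x
  rewrite eval-⊕ (map (a ℤ.*_) q) (0ℤ ∷ (p ⊗ q)) x | eval-scale a q x | eval-⊗ p q x =
  lemma a x (eval p x) (eval q x)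
  where
  lemma : ∀ a x u v → a ℤ.* v ℤ.+ (0ℤ ℤ.+ x ℤ.* (u ℤ.* v)) ≡ (a ℤ.+ x ℤ.* u) ℤ.* v
  lemma = solve-∀

eval-const : ∀ a x → eval (const a) x ≡ a
eval-const a x = trans (cong (ℤ._+_ a) (ℤ.*-zeroʳ x)) (ℤ.+-identityʳ a)

eval-X : ∀ x → eval X x ≡ x
eval-X = lemma
  where
  lemma : ∀ x → 0ℤ ℤ.+ x ℤ.* (1ℤ ℤ.+ x ℤ.* 0ℤ) ≡ x
  lemma = solve-∀

eval-^ : ∀ p k x → eval (p ^ᵖ k) x ≡ eval p x ^ k
eval-^ p zero    x = eval-const 1ℤ x
eval-^ p (suc k) x = trans (eval-⊗ p (p ^ᵖ k) x) (cong (ℤ._*_ (eval p x)) (eval-^ p k x))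

coeff-⊕ : ∀ p q i → coeff (p ⊕ q) i ≡ coeff p i ℤ.+ coeff q i
coeff-⊕ []      q       i       = sym (ℤ.+-identityˡ _)
coeff-⊕ (a ∷ p) []      i       = sym (ℤ.+-identityʳ _)
coeff-⊕ (a ∷ p) (b ∷ q) zero    = refl
coeff-⊕ (a ∷ p) (b ∷ q) (suc i) = coeff-⊕ p q i

coeff-neg : ∀ p i → coeff (map ℤ.-_ p) i ≡ ℤ.- coeff p i
coeff-neg []      i       = refl
coeff-neg (a ∷ p) zero    = refl
coeff-neg (a ∷ p) (suc i) = coeff-neg p i

-- The constant term a is divisible by every positive r, in particular by 1 + |a|;
-- so a = 0, and the variable cancels.

vanishing⇒zero : ∀ p → (∀ r → eval p (+ suc r) ≡ 0ℤ) → ∀ i → coeff p i ≡ 0ℤ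
vanishing⇒zero []      _    i = refl
vanishing⇒zero (a ∷ p) root i = go i
  where
  open ≡-Reasoning

  multiple : ∀ r → a ≡ + suc r ℤ.* (ℤ.- eval p (+ suc r))
  multiple r = begin
    a                                    ≡⟨ lemma a x v ⟩
    (a ℤ.+ x ℤ.* v) ℤ.+ x ℤ.* (ℤ.- v)    ≡⟨ cong (ℤ._+ x ℤ.* (ℤ.- v)) (root r) ⟩
    0ℤ ℤ.+ x ℤ.* (ℤ.- v)                 ≡⟨ ℤ.+-identityˡ _ ⟩
    x ℤ.* (ℤ.- v)                        ∎
    where
    x = + suc r
    v = eval p (+ suc r)
    lemma : ∀ a x v → a ≡ (a ℤ.+ x ℤ.* v) ℤ.+ x ℤ.* (ℤ.- v)
    lemma = solve-∀

  abs-multiple : ∀ r → ℤ.∣ a ∣ ≡ suc r * ℤ.∣ ℤ.- eval p (+ suc r) ∣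
  abs-multiple r = trans (cong ℤ.∣_∣ (multiple r)) (ℤ.abs-* (+ suc r) (ℤ.- eval p (+ suc r)))

  ∣a∣≡0 : ℤ.∣ a ∣ ≡ 0
  ∣a∣≡0 with ℤ.∣ ℤ.- eval p (+ suc ℤ.∣ a ∣) ∣ in eq
  ... | zero  = trans (abs-multiple ℤ.∣ a ∣) (trans (cong (suc ℤ.∣ a ∣ *_) eq) (ℕ.*-zeroʳ (suc ℤ.∣ a ∣)))
  ... | suc j = contradiction
    (ℕ.≤-trans (ℕ.m≤m*n (suc ℤ.∣ a ∣) (suc j))
               (ℕ.≤-reflexive (sym (trans (abs-multiple ℤ.∣ a ∣) (cong (suc ℤ.∣ a ∣ *_) eq)))))
    (ℕ.<-irrefl refl)

  a≡0 : a ≡ 0ℤ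
  a≡0 = ℤ.∣i∣≡0⇒i≡0 ∣a∣≡0

  quotient : ∀ r → eval p (+ suc r) ≡ 0ℤ
  quotient r = ℤ.*-cancelˡ-≡ (+ suc r) (eval p (+ suc r)) 0ℤ (begin
    + suc r ℤ.* eval p (+ suc r)         ≡⟨ ℤ.+-identityˡ _ ⟨
    0ℤ ℤ.+ + suc r ℤ.* eval p (+ suc r)  ≡⟨ cong (ℤ._+ + suc r ℤ.* eval p (+ suc r)) a≡0 ⟨
    a ℤ.+ + suc r ℤ.* eval p (+ suc r)   ≡⟨ root r ⟩
    0ℤ                                   ≡⟨ ℤ.*-zeroʳ (+ suc r) ⟨
    + suc r ℤ.* 0ℤ                       ∎)

  go : ∀ i → coeff (a ∷ p) i ≡ 0ℤ
  go zero    = a≡0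
  go (suc i) = vanishing⇒zero p quotient i

eval-injective : ∀ p q → (∀ r → eval p (+ suc r) ≡ eval q (+ suc r)) → p ≈ q
eval-injective p q agree i = ℤ.i-j≡0⇒i≡j (coeff p i) (coeff q i) (begin
  coeff p i ℤ.- coeff q i    ≡⟨ cong (ℤ._+_ (coeff p i)) (coeff-neg q i) ⟨
  coeff p i ℤ.+ coeff (map ℤ.-_ q) i ≡⟨ coeff-⊕ p (map ℤ.-_ q) i ⟨
  coeff (p ⊖ q) i            ≡⟨ vanishing⇒zero (p ⊖ q) difference i ⟩
  0ℤ                         ∎)
  where
  open ≡-Reasoning
  difference : ∀ r → eval (p ⊖ q) (+ suc r) ≡ 0ℤ
  difference r = trans (eval-⊖ p q (+ suc r)) (ℤ.i≡j⇒i-j≡0 (agree r))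

-- Deletion and contraction for flows

module _ {r : ℕ} where

  private
    p : ℕ
    p = suc r

    residues : List (Fin p)
    residues = allFin p

  𝟙-nowhereZero-∷ : (a : Fin p) (k : Vec (Fin p) m) →
    𝟙 (nowhereZero? {n = n} (a ∷ k)) ≡ (1ℤ ℤ.- 𝟙 (a Fin.≟ zero)) ℤ.* 𝟙 (nowhereZero? {n = n} k)
  𝟙-nowhereZero-∷ {n = n} zero    k = 𝟙-no (nowhereZero? {n = n} (zero ∷ k)) (λ { (0≢0 VecAll.∷ _) → 0≢0 refl })
  𝟙-nowhereZero-∷ {n = n} (suc a) k =
    trans (𝟙-cong (nowhereZero? {n = n} (suc a ∷ k)) (nowhereZero? {n = n} k) VecAll.tail ((λ ()) VecAll.∷_)) (sym (ℤ.*-identityˡ _))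

  ∑-nonzero : (g : Fin p → ℤ) →
    ∑ residues (λ a → (1ℤ ℤ.- 𝟙 (a Fin.≟ zero)) ℤ.* g a) ≡ ∑ residues g ℤ.- g zero
  ∑-nonzero g = begin
    ∑ residues (λ a → (1ℤ ℤ.- 𝟙 (a Fin.≟ zero)) ℤ.* g a)     ≡⟨ ∑-cong residues (λ a → lemma (𝟙 (a Fin.≟ zero)) (g a)) ⟩
    ∑ residues (λ a → g a ℤ.- 𝟙 (a Fin.≟ zero) ℤ.* g a)      ≡⟨ ∑-- residues g (λ a → 𝟙 (a Fin.≟ zero) ℤ.* g a) ⟩
    ∑ residues g ℤ.- ∑ residues (λ a → 𝟙 (a Fin.≟ zero) ℤ.* g a) ≡⟨ cong (ℤ._-_ (∑ residues g)) (∑-δ zero g) ⟩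
    ∑ residues g ℤ.- g zero                                  ∎
    where
    open ≡-Reasoning
    lemma : ∀ d x → (1ℤ ℤ.- d) ℤ.* x ≡ x ℤ.- d ℤ.* x
    lemma = solve-∀

  -- Equal contributions to inflow and outflow cancel at every vertex. This serves two cases: a loop
  -- with any value, and any arc with the value zero.
  conserved-same⇒ : ∀ (e : Fin n × Fin n) (arcs : Arcs n m) a (k : Vec (Fin p) m) →
    (∀ v → δ (proj₂ e) v (toℕ a) ≡ δ (proj₁ e) v (toℕ a)) →
    Conserved (e ∷ arcs) (a ∷ k) → Conserved arcs k
  conserved-same⇒ (s , t) arcs a k same cons v =
    %-+-cancelˡ (δ s v (toℕ a)) (inflow v arcs k) (outflow v arcs k) p
      (trans (cong (λ x → (x ℕ.+ inflow v arcs k) % p) (sym (same v))) (cons v))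

  conserved-same⇐ : ∀ (e : Fin n × Fin n) (arcs : Arcs n m) a (k : Vec (Fin p) m) →
    (∀ v → δ (proj₂ e) v (toℕ a) ≡ δ (proj₁ e) v (toℕ a)) →
    Conserved arcs k → Conserved (e ∷ arcs) (a ∷ k)
  conserved-same⇐ (s , t) arcs a k same cons v =
    %-+-cong (δ t v (toℕ a)) (δ s v (toℕ a)) (inflow v arcs k) (outflow v arcs k) p
      (cong (_% p) (same v)) (cons v)

  𝟙-conserved-same : ∀ (e : Fin n × Fin n) (arcs : Arcs n m) a (k : Vec (Fin p) m) →
    (∀ v → δ (proj₂ e) v (toℕ a) ≡ δ (proj₁ e) v (toℕ a)) →
    𝟙 (conserved? (e ∷ arcs) (a ∷ k)) ≡ 𝟙 (conserved? arcs k)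
  𝟙-conserved-same e arcs a k same =
    𝟙-cong (conserved? (e ∷ arcs) (a ∷ k)) (conserved? arcs k)
           (conserved-same⇒ e arcs a k same) (conserved-same⇐ e arcs a k same)

  flowCount-∑ : (arcs : Arcs n m) → + flowCount arcs p ≡
    ∑ (words m residues) (λ k → 𝟙 (nowhereZero? {n = n} k) ℤ.* 𝟙 (conserved? arcs k))
  flowCount-∑ {n = n} {m = m} arcs =
    trans (length-filter-∑ (isNowhereZeroFlow? arcs) (words m residues))
          (∑-cong (words m residues) (λ k → 𝟙-× (nowhereZero? {n = n} k) (conserved? arcs k)))

  -- The value on `e` is first allowed to be any residue, and the value zero is then subtracted; an
  -- arc of value zero can be deleted. Loops and other arcs now differ only in the inner sum.
  flowCount-∷ : (e : Fin n × Fin n) (arcs : Arcs n m) →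
    + flowCount (e ∷ arcs) p ≡
    ∑ (words m residues) (λ k → 𝟙 (nowhereZero? {n = n} k) ℤ.*
      ∑ residues (λ a → 𝟙 (conserved? (e ∷ arcs) (a ∷ k)))) ℤ.- + flowCount arcs p
  flowCount-∷ {n = n} {m = m} e arcs = begin
    + flowCount (e ∷ arcs) p
      ≡⟨ flowCount-∑ (e ∷ arcs) ⟩
    ∑ (words (suc m) residues) (λ k → nz k ℤ.* C k)
      ≡⟨ ∑-words-suc m residues _ ⟩
    ∑ residues (λ a → ∑ ks (λ k → nz (a ∷ k) ℤ.* C (a ∷ k)))
      ≡⟨ ∑-cong residues (λ a → ∑-cong ks (λ k →
           trans (cong (ℤ._* C (a ∷ k)) (𝟙-nowhereZero-∷ {n = n} a k))
                 (lemma₁ (1ℤ ℤ.- 𝟙 (a Fin.≟ zero)) (nz k) (C (a ∷ k))))) ⟩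
    ∑ residues (λ a → ∑ ks (λ k → nz k ℤ.* ((1ℤ ℤ.- 𝟙 (a Fin.≟ zero)) ℤ.* C (a ∷ k))))
      ≡⟨ ∑-swap residues ks _ ⟩
    ∑ ks (λ k → ∑ residues (λ a → nz k ℤ.* ((1ℤ ℤ.- 𝟙 (a Fin.≟ zero)) ℤ.* C (a ∷ k))))
      ≡⟨ ∑-cong ks (λ k → trans (∑-*ˡ residues (nz k) _) (cong (ℤ._*_ (nz k)) (∑-nonzero (λ a → C (a ∷ k))))) ⟩
    ∑ ks (λ k → nz k ℤ.* (∑ residues (λ a → C (a ∷ k)) ℤ.- C (zero ∷ k)))
      ≡⟨ ∑-cong ks (λ k → trans (cong (λ x → nz k ℤ.* (∑ residues (λ a → C (a ∷ k)) ℤ.- x)) (at-zero k))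
                                (lemma₂ (nz k) (∑ residues (λ a → C (a ∷ k))) (C₀ k))) ⟩
    ∑ ks (λ k → nz k ℤ.* ∑ residues (λ a → C (a ∷ k)) ℤ.- nz k ℤ.* C₀ k)
      ≡⟨ ∑-- ks _ _ ⟩
    ∑ ks (λ k → nz k ℤ.* ∑ residues (λ a → C (a ∷ k))) ℤ.- ∑ ks (λ k → nz k ℤ.* C₀ k)
      ≡⟨ cong (ℤ._-_ (∑ ks (λ k → nz k ℤ.* ∑ residues (λ a → C (a ∷ k))))) (flowCount-∑ arcs) ⟨
    ∑ ks (λ k → nz k ℤ.* ∑ residues (λ a → C (a ∷ k))) ℤ.- + flowCount arcs p ∎
    where
    open ≡-Reasoning
    ks : List (Vec (Fin p) m)
    ks = words m residues
    nz : ∀ {m} → Vec (Fin p) m → ℤ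
    nz k = 𝟙 (nowhereZero? {n = n} k)
    C : Vec (Fin p) (suc m) → ℤ
    C k = 𝟙 (conserved? (e ∷ arcs) k)
    C₀ : Vec (Fin p) m → ℤ
    C₀ k = 𝟙 (conserved? arcs k)
    at-zero : ∀ k → C (zero ∷ k) ≡ C₀ k
    at-zero k = 𝟙-conserved-same e arcs zero k (λ v → trans (δ-0 (proj₂ e) v) (sym (δ-0 (proj₁ e) v)))
    lemma₁ : ∀ d x c → d ℤ.* x ℤ.* c ≡ x ℤ.* (d ℤ.* c)
    lemma₁ = solve-∀
    lemma₂ : ∀ x y c → x ℤ.* (y ℤ.- c) ≡ x ℤ.* y ℤ.- x ℤ.* c
    lemma₂ = solve-∀

  flowCount-[] : + flowCount {n} [] p ≡ 1ℤ
  flowCount-[] {n} = begin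
    + flowCount {n} [] p         ≡⟨ flowCount-∑ {n = n} [] ⟩
    1ℤ ℤ.* 𝟙 C ℤ.+ 0ℤ            ≡⟨ ℤ.+-identityʳ (1ℤ ℤ.* 𝟙 C) ⟩
    1ℤ ℤ.* 𝟙 C                   ≡⟨ ℤ.*-identityˡ (𝟙 C) ⟩
    𝟙 C                          ≡⟨ 𝟙-yes C (λ _ → refl) ⟩
    1ℤ                           ∎
    where
    open ≡-Reasoning
    C : Dec (Conserved {n = n} {q = p} [] [])
    C = conserved? {q = p} {n = n} [] []

  flowCount-loop : (v : Fin n) (arcs : Arcs n m) →
    + flowCount ((v , v) ∷ arcs) p ≡ (+ p ℤ.- 1ℤ) ℤ.* + flowCount arcs p
  flowCount-loop {n = n} {m = m} v arcs = begin
    + flowCount ((v , v) ∷ arcs) p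
      ≡⟨ flowCount-∷ (v , v) arcs ⟩
    ∑ ks (λ k → nz k ℤ.* ∑ residues (λ a → 𝟙 (conserved? ((v , v) ∷ arcs) (a ∷ k)))) ℤ.- N
      ≡⟨ cong (ℤ._- N) (∑-cong ks (λ k → trans (cong (ℤ._*_ (nz k)) (free k)) (lemma₁ (nz k) (+ p) (C₀ k)))) ⟩
    ∑ ks (λ k → + p ℤ.* (nz k ℤ.* C₀ k)) ℤ.- N
      ≡⟨ cong (ℤ._- N) (trans (∑-*ˡ ks (+ p) _) (cong (ℤ._*_ (+ p)) (sym (flowCount-∑ arcs)))) ⟩
    + p ℤ.* N ℤ.- N
      ≡⟨ lemma₂ (+ p) N ⟩
    (+ p ℤ.- 1ℤ) ℤ.* N ∎
    where
    open ≡-Reasoning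
    N : ℤ
    N = + flowCount arcs p
    ks : List (Vec (Fin p) m)
    ks = words m residues
    nz C₀ : Vec (Fin p) m → ℤ
    nz k = 𝟙 (nowhereZero? {n = n} k)
    C₀ k = 𝟙 (conserved? arcs k)
    free : ∀ k → ∑ residues (λ a → 𝟙 (conserved? ((v , v) ∷ arcs) (a ∷ k))) ≡ + p ℤ.* C₀ k
    free k = trans (∑-cong residues (λ a → 𝟙-conserved-same (v , v) arcs a k (λ _ → refl)))
                   (∑-allFin-const p (C₀ k))
    lemma₁ : ∀ x q c → x ℤ.* (q ℤ.* c) ≡ q ℤ.* (x ℤ.* c)
    lemma₁ = solve-∀
    lemma₂ : ∀ q c → q ℤ.* c ℤ.- c ≡ (q ℤ.- 1ℤ) ℤ.* c
    lemma₂ = solve-∀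

  -- For each `k` conserved on the contracted arcs exactly one residue on the arc completes it,
  -- namely `balancing`. That residue may be zero, which is the case subtracted in `flowCount-∷`.
  flowCount-contract : {s t : Fin n} → s ≢ t → (arcs : Arcs n m) →
    + flowCount ((s , t) ∷ arcs) p ≡ + flowCount (contract s t arcs) p ℤ.- + flowCount arcs p
  flowCount-contract {n = n} {m = m} {s} {t} s≢t arcs =
    trans (flowCount-∷ (s , t) arcs)
      (cong (ℤ._- + flowCount arcs p)
        (trans (∑-cong (words m residues) (λ k → cong (ℤ._*_ (𝟙 (nowhereZero? {n = n} k))) (forced k)))
               (sym (flowCount-∑ (contract s t arcs)))))
    where
    open ≡-Reasoning
    forced : ∀ k → ∑ residues (λ a → 𝟙 (conserved? ((s , t) ∷ arcs) (a ∷ k)))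
                   ≡ 𝟙 (conserved? (contract s t arcs) k)
    forced k = begin
      ∑ residues (λ a → 𝟙 (conserved? ((s , t) ∷ arcs) (a ∷ k)))
        ≡⟨ ∑-cong residues (λ a → 𝟙-cong (conserved? ((s , t) ∷ arcs) (a ∷ k))
             (a Fin.≟ b ×-dec conserved? (contract s t arcs) k)
             (conserved-extend⇒ s≢t arcs k a) (conserved-extend⇐ s≢t arcs k a)) ⟩
      ∑ residues (λ a → 𝟙 (a Fin.≟ b ×-dec conserved? (contract s t arcs) k))
        ≡⟨ ∑-cong residues (λ a → 𝟙-× (a Fin.≟ b) (conserved? (contract s t arcs) k)) ⟩
      ∑ residues (λ a → 𝟙 (a Fin.≟ b) ℤ.* 𝟙 (conserved? (contract s t arcs) k))
        ≡⟨ ∑-δ b (λ _ → 𝟙 (conserved? (contract s t arcs) k)) ⟩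
      𝟙 (conserved? (contract s t arcs) k) ∎
      where b = balancing s≢t arcs k

-- Flows and colourings

-- The witness for existence, read off from the recurrences for loops and other arcs. The recursion
-- is on the number `m` of arcs, because `contract s t arcs` is not a subterm but has the same
-- length as `arcs`.
flowPoly : Arcs n m → Poly
flowPoly {m = zero}  []             = const 1ℤ
flowPoly {m = suc m} ((s , t) ∷ arcs) =
  if does (s Fin.≟ t) then (X ⊖ const 1ℤ) ⊗ flowPoly arcs
                      else flowPoly (contract s t arcs) ⊖ flowPoly arcs

eval-flowPoly : (arcs : Arcs n m) (r : ℕ) → eval (flowPoly arcs) (+ suc r) ≡ + flowCount arcs (suc r)
eval-flowPoly {n = n} {m = zero}  [] r = trans (eval-const 1ℤ (+ suc r)) (sym (flowCount-[] {r} {n}))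
eval-flowPoly {m = suc m} ((s , t) ∷ arcs) r with s Fin.≟ t
... | yes refl = begin
  eval ((X ⊖ const 1ℤ) ⊗ flowPoly arcs) x               ≡⟨ eval-⊗ (X ⊖ const 1ℤ) (flowPoly arcs) x ⟩
  eval (X ⊖ const 1ℤ) x ℤ.* eval (flowPoly arcs) x      ≡⟨ cong₂ ℤ._*_ linear (eval-flowPoly arcs r) ⟩
  (x ℤ.- 1ℤ) ℤ.* + flowCount arcs (suc r)               ≡⟨ flowCount-loop s arcs ⟨
  + flowCount ((s , s) ∷ arcs) (suc r)                  ∎
  where
  open ≡-Reasoning
  x = + suc r
  linear : eval (X ⊖ const 1ℤ) x ≡ x ℤ.- 1ℤ
  linear = trans (eval-⊖ X (const 1ℤ) x) (cong₂ ℤ._-_ (eval-X x) (eval-const 1ℤ x))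
... | no s≢t = begin
  eval (flowPoly (contract s t arcs) ⊖ flowPoly arcs) x
    ≡⟨ eval-⊖ (flowPoly (contract s t arcs)) (flowPoly arcs) x ⟩
  eval (flowPoly (contract s t arcs)) x ℤ.- eval (flowPoly arcs) x
    ≡⟨ cong₂ ℤ._-_ (eval-flowPoly (contract s t arcs) r) (eval-flowPoly arcs r) ⟩
  + flowCount (contract s t arcs) (suc r) ℤ.- + flowCount arcs (suc r)
    ≡⟨ flowCount-contract s≢t arcs ⟨
  + flowCount ((s , t) ∷ arcs) (suc r) ∎
  where
  open ≡-Reasoning
  x = + suc r

-- Overwriting position `t` forgets the old entry, which could have been any member of `xs`; hence
-- the factor.
∑-update : (xs : List A) (t : Fin n) (g : Vec A n → ℤ) →
  ∑ (words n xs) (λ c → ∑ xs (λ a → g (c [ t ]≔ a))) ≡ + length xs ℤ.* ∑ (words n xs) g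
∑-update {n = suc n} xs zero g = begin
  ∑ (words (suc n) xs) (λ c → ∑ xs (λ a → g (c [ zero ]≔ a)))
    ≡⟨ ∑-words-suc n xs _ ⟩
  ∑ xs (λ _ → ∑ (words n xs) (λ c → ∑ xs (λ a → g (a ∷ c))))
    ≡⟨ ∑-const xs _ ⟩
  + length xs ℤ.* ∑ (words n xs) (λ c → ∑ xs (λ a → g (a ∷ c)))
    ≡⟨ cong (ℤ._*_ (+ length xs)) (trans (∑-swap (words n xs) xs _) (sym (∑-words-suc n xs g))) ⟩
  + length xs ℤ.* ∑ (words (suc n) xs) g ∎
  where open ≡-Reasoning
∑-update {n = suc n} xs (suc t) g = begin
  ∑ (words (suc n) xs) (λ c → ∑ xs (λ a → g (c [ suc t ]≔ a)))
    ≡⟨ ∑-words-suc n xs _ ⟩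
  ∑ xs (λ b → ∑ (words n xs) (λ c → ∑ xs (λ a → g (b ∷ (c [ t ]≔ a)))))
    ≡⟨ ∑-cong xs (λ b → ∑-update xs t (λ c → g (b ∷ c))) ⟩
  ∑ xs (λ b → + length xs ℤ.* ∑ (words n xs) (λ c → g (b ∷ c)))
    ≡⟨ trans (∑-*ˡ xs (+ length xs) _) (cong (ℤ._*_ (+ length xs)) (sym (∑-words-suc n xs g))) ⟩
  + length xs ℤ.* ∑ (words (suc n) xs) g ∎
  where open ≡-Reasoning

∑-words-1 : ∀ n (xs : List A) → ∑ (words n xs) (λ _ → 1ℤ) ≡ (+ length xs) ^ n
∑-words-1 zero    xs = refl
∑-words-1 (suc n) xs =
  trans (∑-words-suc n xs _) (trans (∑-const xs _) (cong (ℤ._*_ (+ length xs)) (∑-words-1 n xs)))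

lookup-update-merge : (c : Vec A n) (s t u : Fin n) →
  lookup (c [ t ]≔ lookup c s) u ≡ lookup c (merge s t u)
lookup-update-merge c s t u with u Fin.≟ t
... | yes refl = lookup∘update t c (lookup c s)
... | no u≢t   = lookup∘update′ u≢t c (lookup c s)

module _ {q : ℕ} where

  private
    colours : List (Fin q)
    colours = allFin q

    |colours| : length colours ≡ q
    |colours| = length-tabulate {n = q} id

  colourWeight : Vec (Fin q) n → Arcs n m → ℤ
  colourWeight c []               = 1ℤ
  colourWeight c ((s , t) ∷ arcs) =
    (+ q ℤ.* 𝟙 (lookup c s Fin.≟ lookup c t) ℤ.- 1ℤ) ℤ.* colourWeight c arcs

  colourSum : Arcs n m → ℤ
  colourSum {n = n} arcs = ∑ (words n colours) (λ c → colourWeight c arcs)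

  colourWeight-contract : (c : Vec (Fin q) n) (s t : Fin n) (arcs : Arcs n m) →
    colourWeight c (contract s t arcs) ≡ colourWeight (c [ t ]≔ lookup c s) arcs
  colourWeight-contract c s t []               = refl
  colourWeight-contract c s t ((u , v) ∷ arcs)
    rewrite lookup-update-merge c s t u | lookup-update-merge c s t v | colourWeight-contract c s t arcs = refl

  -- Colouring the contracted arcs by `c` amounts to colouring the original ones after giving `t`
  -- the colour of `s`. This reaches only colourings in which `s` and `t` agree, and each of them
  -- from `q` colourings, one for every lost colour of `t`.
  colourSum-contract : {s t : Fin n} → s ≢ t → (arcs : Arcs n m) →
    colourSum (contract s t arcs) ≡
    + q ℤ.* ∑ (words n colours) (λ c → 𝟙 (lookup c s Fin.≟ lookup c t) ℤ.* colourWeight c arcs)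
  colourSum-contract {n = n} {s = s} {t} s≢t arcs = begin
    ∑ cs (λ c → colourWeight c (contract s t arcs))
      ≡⟨ ∑-cong cs (λ c → colourWeight-contract c s t arcs) ⟩
    ∑ cs (λ c → colourWeight (c [ t ]≔ lookup c s) arcs)
      -- The forced colour is written as a sum over all colours `a` with an indicator, which is the
      -- shape that `∑-update` evaluates.
      ≡⟨ ∑-cong cs (λ c → sym (∑-δ (lookup c s) (λ a → colourWeight (c [ t ]≔ a) arcs))) ⟩
    ∑ cs (λ c → ∑ colours (λ a → 𝟙 (a Fin.≟ lookup c s) ℤ.* colourWeight (c [ t ]≔ a) arcs))
      ≡⟨ ∑-cong cs (λ c → ∑-cong colours (λ a →
           cong (ℤ._* colourWeight (c [ t ]≔ a) arcs) (ends c a))) ⟩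
    ∑ cs (λ c → ∑ colours (λ a → mono (c [ t ]≔ a)))
      ≡⟨ ∑-update colours t mono ⟩
    + length colours ℤ.* ∑ cs mono
      ≡⟨ cong (λ k → + k ℤ.* ∑ cs mono) |colours| ⟩
    + q ℤ.* ∑ cs mono ∎
    where
    open ≡-Reasoning
    cs : List (Vec (Fin q) n)
    cs = words n colours
    mono : Vec (Fin q) n → ℤ
    mono c = 𝟙 (lookup c s Fin.≟ lookup c t) ℤ.* colourWeight c arcs
    ends : ∀ c a → 𝟙 (a Fin.≟ lookup c s) ≡ 𝟙 (lookup (c [ t ]≔ a) s Fin.≟ lookup (c [ t ]≔ a) t)
    ends c a rewrite lookup∘update′ s≢t c a | lookup∘update t c a =
      𝟙-cong (a Fin.≟ lookup c s) (lookup c s Fin.≟ a) sym sym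

  colourSum-reorient : {arcs edges : Arcs n m} →
    Pointwise (λ a e → a ≡ e ⊎ a ≡ swap e) arcs edges → colourSum arcs ≡ colourSum edges
  colourSum-reorient {n = n} reorientation = ∑-cong (words n colours) (λ c → weight c reorientation)
    where
    weight : ∀ {m} {arcs edges : Arcs n m} c →
      Pointwise (λ a e → a ≡ e ⊎ a ≡ swap e) arcs edges → colourWeight c arcs ≡ colourWeight c edges
    weight c []                 = refl
    weight c (_∷_ {x = s , t} (inj₁ refl) rest) =
      cong (ℤ._*_ (+ q ℤ.* 𝟙 (lookup c s Fin.≟ lookup c t) ℤ.- 1ℤ)) (weight c rest)
    weight c (_∷_ {y = s , t} (inj₂ refl) rest) =
      cong₂ (λ x y → (+ q ℤ.* x ℤ.- 1ℤ) ℤ.* y)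
            (𝟙-cong (lookup c t Fin.≟ lookup c s) (lookup c s Fin.≟ lookup c t) sym sym)
            (weight c rest)

-- Contracting keeps the number of vertices, hence the exponent n throughout.

flowCount-colourSum : (arcs : Arcs n m) (r : ℕ) →
  (+ suc r) ^ n ℤ.* + flowCount arcs (suc r) ≡ colourSum {q = suc r} arcs
flowCount-colourSum {n = n} {m = zero} [] r = begin
  x ^ n ℤ.* + flowCount {n} [] (suc r)       ≡⟨ cong (ℤ._*_ (x ^ n)) (flowCount-[] {r} {n}) ⟩
  x ^ n ℤ.* 1ℤ                               ≡⟨ ℤ.*-identityʳ (x ^ n) ⟩
  x ^ n                                      ≡⟨ cong (λ k → (+ k) ^ n) (length-tabulate {n = suc r} id) ⟨
  (+ length (allFin (suc r))) ^ n            ≡⟨ ∑-words-1 n (allFin (suc r)) ⟨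
  colourSum {q = suc r} {n = n} []           ∎
  where
  open ≡-Reasoning
  x = + suc r
flowCount-colourSum {n = n} {m = suc m} ((s , t) ∷ arcs) r with s Fin.≟ t
... | yes refl = begin
  x ^ n ℤ.* + flowCount ((s , s) ∷ arcs) (suc r)     ≡⟨ cong (ℤ._*_ (x ^ n)) (flowCount-loop s arcs) ⟩
  x ^ n ℤ.* ((x ℤ.- 1ℤ) ℤ.* N)                       ≡⟨ lemma (x ^ n) (x ℤ.- 1ℤ) N ⟩
  (x ℤ.- 1ℤ) ℤ.* (x ^ n ℤ.* N)                       ≡⟨ cong (ℤ._*_ (x ℤ.- 1ℤ)) (flowCount-colourSum arcs r) ⟩
  (x ℤ.- 1ℤ) ℤ.* colourSum arcs                      ≡⟨ ∑-*ˡ cs (x ℤ.- 1ℤ) _ ⟨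
  ∑ cs (λ c → (x ℤ.- 1ℤ) ℤ.* colourWeight c arcs)    ≡⟨ ∑-cong cs (λ c → cong (λ y → (y ℤ.- 1ℤ) ℤ.* colourWeight c arcs) (mono c)) ⟩
  colourSum ((s , s) ∷ arcs)                         ∎
  where
  open ≡-Reasoning
  x = + suc r
  N = + flowCount arcs (suc r)
  cs = words n (allFin (suc r))
  mono : ∀ c → x ≡ x ℤ.* 𝟙 (lookup c s Fin.≟ lookup c s)
  mono c = sym (trans (cong (ℤ._*_ x) (𝟙-yes (lookup c s Fin.≟ lookup c s) refl)) (ℤ.*-identityʳ x))
  lemma : ∀ a b c → a ℤ.* (b ℤ.* c) ≡ b ℤ.* (a ℤ.* c)
  lemma = solve-∀
... | no s≢t = begin
  x ^ n ℤ.* + flowCount ((s , t) ∷ arcs) (suc r)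
    ≡⟨ cong (ℤ._*_ (x ^ n)) (flowCount-contract s≢t arcs) ⟩
  x ^ n ℤ.* (+ flowCount (contract s t arcs) (suc r) ℤ.- + flowCount arcs (suc r))
    ≡⟨ lemma₁ (x ^ n) (+ flowCount (contract s t arcs) (suc r)) (+ flowCount arcs (suc r)) ⟩
  x ^ n ℤ.* + flowCount (contract s t arcs) (suc r) ℤ.- x ^ n ℤ.* + flowCount arcs (suc r)
    ≡⟨ cong₂ ℤ._-_ (flowCount-colourSum (contract s t arcs) r) (flowCount-colourSum arcs r) ⟩
  colourSum (contract s t arcs) ℤ.- colourSum arcs
    ≡⟨ cong (ℤ._- colourSum arcs) (trans (colourSum-contract s≢t arcs) (sym (∑-*ˡ cs x _))) ⟩
  ∑ cs (λ c → x ℤ.* (d c ℤ.* w c)) ℤ.- ∑ cs w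
    ≡⟨ ∑-- cs _ w ⟨
  ∑ cs (λ c → x ℤ.* (d c ℤ.* w c) ℤ.- w c)
    ≡⟨ ∑-cong cs (λ c → lemma₂ x (d c) (w c)) ⟩
  colourSum ((s , t) ∷ arcs) ∎
  where
  open ≡-Reasoning
  x = + suc r
  cs = words n (allFin (suc r))
  d w : Vec (Fin (suc r)) n → ℤ
  d c = 𝟙 (lookup c s Fin.≟ lookup c t)
  w c = colourWeight c arcs
  lemma₁ : ∀ a b c → a ℤ.* (b ℤ.- c) ≡ a ℤ.* b ℤ.- a ℤ.* c
  lemma₁ = solve-∀
  lemma₂ : ∀ x d w → x ℤ.* (d ℤ.* w) ℤ.- w ≡ (x ℤ.* d ℤ.- 1ℤ) ℤ.* w
  lemma₂ = solve-∀

^-nonZero : ∀ r n → ℤ.NonZero ((+ suc r) ^ n)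
^-nonZero r zero    = _
^-nonZero r (suc n) = ℤ.i*j≢0 (+ suc r) ((+ suc r) ^ n) {{_}} {{^-nonZero r n}}

-- `flowPoly` is computed from one orientation, the listed order of the ends, while the count must
-- be right for all of them. Colour sums are symmetric in the two ends, and cancelling the power of
-- `x` carries this over to the counts.
flowPoly-isFlowPolynomial : (G : Graph) → IsFlowPolynomial G (flowPoly (Graph.edges G))
flowPoly-isFlowPolynomial G arcs orients (suc r) =
  trans (eval-flowPoly edges r)
    (ℤ.*-cancelˡ-≡ (x ^ order) (+ flowCount edges (suc r)) (+ flowCount arcs (suc r)) {{^-nonZero r order}} (begin
      x ^ order ℤ.* + flowCount edges (suc r)   ≡⟨ flowCount-colourSum edges r ⟩
      colourSum edges                           ≡⟨ colourSum-reorient orients ⟨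
      colourSum arcs                            ≡⟨ flowCount-colourSum arcs r ⟨
      x ^ order ℤ.* + flowCount arcs (suc r)    ∎))
  where
  open ≡-Reasoning
  open Graph G
  x = + suc r

-- Tuples of classes and set partitions

falling : ℤ → ℕ → ℤ
falling x zero    = 1ℤ
falling x (suc k) = falling x k ℤ.* (x ℤ.- + k)

-- `falling` grows by its last factor; here the first one is split off.
falling-shift : ∀ x k → falling (1ℤ ℤ.+ x) (suc k) ≡ (1ℤ ℤ.+ x) ℤ.* falling x k
falling-shift x zero    = lemma x
  where
  lemma : ∀ x → 1ℤ ℤ.* (1ℤ ℤ.+ x ℤ.- 0ℤ) ≡ (1ℤ ℤ.+ x) ℤ.* 1ℤ
  lemma = solve-∀
falling-shift x (suc k) =
  trans (cong (ℤ._* (1ℤ ℤ.+ x ℤ.- + suc k)) (falling-shift x k)) (lemma x (falling x k) (+ k))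
  where
  lemma : ∀ x f k → (1ℤ ℤ.+ x) ℤ.* f ℤ.* (1ℤ ℤ.+ x ℤ.- (1ℤ ℤ.+ k)) ≡ (1ℤ ℤ.+ x) ℤ.* (f ℤ.* (x ℤ.- k))
  lemma = solve-∀

-- For natural x: among the injective assignments of 1 + x colours to k blocks, either the
-- additional colour is absent or one of the k blocks has it. At k = 0 the factor `+ k` makes the
-- default value of `pred` harmless.
falling-difference : ∀ x k → falling (1ℤ ℤ.+ x) k ≡ falling x k ℤ.+ + k ℤ.* falling x (ℕ.pred k)
falling-difference x zero    = refl
falling-difference x (suc k) = trans (falling-shift x k) (lemma x (falling x k) (+ k))
  where
  lemma : ∀ x f k → (1ℤ ℤ.+ x) ℤ.* f ≡ f ℤ.* (x ℤ.- k) ℤ.+ (1ℤ ℤ.+ k) ℤ.* f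
  lemma = solve-∀

-- Families with a marked member

picks : List A → List (A × List A)
picks []       = []
picks (x ∷ xs) = (x , xs) ∷ map (λ (y , ys) → y , x ∷ ys) (picks xs)

picks-↭ : (xs : List A) → All (λ (y , ys) → y ∷ ys ↭ xs) (picks xs)
picks-↭ []       = []
picks-↭ (x ∷ xs) = ↭-refl ∷ All.map⁺ (All.map (λ p → ↭-trans (↭-swap _ _ ↭-refl) (prep x p)) (picks-↭ xs))

length-picks : (xs : List A) → length (picks xs) ≡ length xs
length-picks []       = refl
length-picks (x ∷ xs) = cong suc (trans (length-map _ (picks xs)) (length-picks xs))

-- Turns the factor k of `falling-difference` into a sum over the choice of a marked block.
∑-picks : (h : List A → ℤ) → (∀ {xs ys} → xs ↭ ys → h xs ≡ h ys) →
          ∀ xs → ∑ (picks xs) (λ (y , ys) → h (y ∷ ys)) ≡ + length xs ℤ.* h xs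
∑-picks h h-resp-↭ xs = begin
  ∑ (picks xs) (λ (y , ys) → h (y ∷ ys))    ≡⟨ ∑-congᴬ (All.map h-resp-↭ (picks-↭ xs)) ⟩
  ∑ (picks xs) (λ _ → h xs)                 ≡⟨ ∑-const (picks xs) (h xs) ⟩
  + length (picks xs) ℤ.* h xs              ≡⟨ cong (λ k → + k ℤ.* h xs) (length-picks xs) ⟩
  + length xs ℤ.* h xs                      ∎
  where open ≡-Reasoning

∑-sublists-∷ : (x : A) (xs : List A) (g : List A → ℤ) →
  ∑ (sublists (x ∷ xs)) g ≡ ∑ (sublists xs) (λ π → g (x ∷ π)) ℤ.+ ∑ (sublists xs) g
∑-sublists-∷ x xs g =
  trans (∑-++ (map (x ∷_) (sublists xs)) (sublists xs) g)
        (cong (ℤ._+ ∑ (sublists xs) g) (∑-map (x ∷_) (sublists xs) g))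

-- A family with a marked member corresponds to an element x together with a family without x. The
-- right side also runs over the families that contain x, and `vanish` removes these.
∑-picks-swap : (xs : List A) (g : A → List A → ℤ) → (∀ {x π} → x ∈ˡ π → g x π ≡ 0ℤ) →
  ∑ (sublists xs) (λ π → ∑ (picks π) (uncurry g)) ≡ ∑ xs (λ x → ∑ (sublists xs) (g x))
∑-picks-swap []       g vanish = refl
∑-picks-swap (x ∷ xs) g vanish = begin
  ∑ (sublists (x ∷ xs)) (λ π → ∑ (picks π) (uncurry g))
    ≡⟨ ∑-sublists-∷ x xs _ ⟩
  ∑ S (λ π → g x π ℤ.+ ∑ (map (λ (y , ys) → y , x ∷ ys) (picks π)) (uncurry g)) ℤ.+ ∑ S (λ π → ∑ (picks π) (uncurry g))
    ≡⟨ cong (ℤ._+ ∑ S (λ π → ∑ (picks π) (uncurry g)))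
         (trans (∑-cong S (λ π → cong (ℤ._+_ (g x π)) (∑-map _ (picks π) (uncurry g))))
                (∑-+ S (g x) (λ π → ∑ (picks π) (uncurry g⁺)))) ⟩
  ∑ S (g x) ℤ.+ ∑ S (λ π → ∑ (picks π) (uncurry g⁺)) ℤ.+ ∑ S (λ π → ∑ (picks π) (uncurry g))
    ≡⟨ cong₂ (λ a b → ∑ S (g x) ℤ.+ a ℤ.+ b) (∑-picks-swap xs g⁺ (λ y∈π → vanish (there y∈π))) (∑-picks-swap xs g vanish) ⟩
  ∑ S (g x) ℤ.+ ∑ xs (λ y → ∑ S (g⁺ y)) ℤ.+ ∑ xs (λ y → ∑ S (g y))
    ≡⟨ ℤ.+-assoc (∑ S (g x)) (∑ xs (λ y → ∑ S (g⁺ y))) (∑ xs (λ y → ∑ S (g y))) ⟩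
  ∑ S (g x) ℤ.+ (∑ xs (λ y → ∑ S (g⁺ y)) ℤ.+ ∑ xs (λ y → ∑ S (g y)))
    ≡⟨ cong₂ ℤ._+_ (sym self) (trans (sym (∑-+ xs (λ y → ∑ S (g⁺ y)) (λ y → ∑ S (g y))))
                                     (∑-cong xs (λ y → sym (∑-sublists-∷ x xs (g y))))) ⟩
  ∑ (x ∷ xs) (λ y → ∑ (sublists (x ∷ xs)) (g y)) ∎
  where
  open ≡-Reasoning
  S  = sublists xs
  g⁺ = λ y π → g y (x ∷ π)
  -- For the marked element `x` itself, the sublists that contain `x` contribute nothing.
  self : ∑ (sublists (x ∷ xs)) (g x) ≡ ∑ S (g x)
  self = begin
    ∑ (sublists (x ∷ xs)) (g x)        ≡⟨ ∑-sublists-∷ x xs (g x) ⟩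
    ∑ S (g⁺ x) ℤ.+ ∑ S (g x)           ≡⟨ cong (ℤ._+ ∑ S (g x)) (trans (∑-cong S (λ π → vanish (here refl))) (∑-0 S)) ⟩
    0ℤ ℤ.+ ∑ S (g x)                   ≡⟨ ℤ.+-identityˡ _ ⟩
    ∑ S (g x)                          ∎

subsets : (n : ℕ) → List (Subset n)
subsets n = words n (true ∷ false ∷ [])

∑-subsets-suc : ∀ n (g : Subset (suc n) → ℤ) →
  ∑ (subsets (suc n)) g ≡ ∑ (subsets n) (λ B → g (inside ∷ B)) ℤ.+ ∑ (subsets n) (λ B → g (outside ∷ B))
∑-subsets-suc n g = trans (∑-words-suc n (true ∷ false ∷ []) g)
  (cong (ℤ._+_ (∑ (subsets n) (λ B → g (inside ∷ B)))) (ℤ.+-identityʳ _))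

∑-empty : ∀ n (g : Subset n → ℤ) →
  ∑ (subsets n) (λ B → (1ℤ ℤ.- 𝟙 (nonempty? B)) ℤ.* g B) ≡ g ⊥
∑-empty zero    g = lemma (g [])
  where
  lemma : ∀ x → (1ℤ ℤ.- 0ℤ) ℤ.* x ℤ.+ 0ℤ ≡ x
  lemma = solve-∀
∑-empty (suc n) g = begin
  ∑ (subsets (suc n)) (λ B → (1ℤ ℤ.- 𝟙 (nonempty? B)) ℤ.* g B)
    ≡⟨ ∑-subsets-suc n _ ⟩
  ∑ (subsets n) (λ B → (1ℤ ℤ.- 𝟙 (nonempty? (inside ∷ B))) ℤ.* g (inside ∷ B)) ℤ.+
  ∑ (subsets n) (λ B → (1ℤ ℤ.- 𝟙 (nonempty? (outside ∷ B))) ℤ.* g (outside ∷ B))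
    ≡⟨ cong₂ ℤ._+_
         (trans (∑-cong (subsets n) (λ B → cong (λ d → (1ℤ ℤ.- d) ℤ.* g (inside ∷ B))
                                                (𝟙-yes (nonempty? (inside ∷ B)) (zero , Vec.here))))
                (∑-0 (subsets n)))
         (∑-cong (subsets n) (λ B → cong (λ d → (1ℤ ℤ.- d) ℤ.* g (outside ∷ B))
            (𝟙-cong (nonempty? (outside ∷ B)) (nonempty? B)
                    (λ { (suc i , Vec.there i∈B) → i , i∈B }) (λ (i , i∈B) → suc i , Vec.there i∈B)))) ⟩
  0ℤ ℤ.+ ∑ (subsets n) (λ B → (1ℤ ℤ.- 𝟙 (nonempty? B)) ℤ.* g (outside ∷ B))
    ≡⟨ trans (ℤ.+-identityˡ _) (∑-empty n (λ B → g (outside ∷ B))) ⟩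
  g ⊥ ∎
  where open ≡-Reasoning

coverage : Fin n → List (Subset n) → ℕ
coverage i π = length (filter (i ∈?_) π)

coverage-∷ : (i : Fin n) (B : Subset n) (π : List (Subset n)) →
  coverage i (B ∷ π) ≡ coverage i (B ∷ []) ℕ.+ coverage i π
coverage-∷ i B π with i ∈? B
... | yes _ = refl
... | no _  = refl

coverage-∉ : {i : Fin n} {B : Subset n} → i ∉ B → coverage i (B ∷ []) ≡ 0
coverage-∉ {i = i} {B} i∉B with i ∈? B
... | yes i∈B = contradiction i∈B i∉B
... | no _    = refl

-- σ collects the blocks already chosen, so that removing a block from π needs
-- no subtraction of subsets.

Complementary : (σ π : List (Subset n)) → Set
Complementary σ π = ∀ i → coverage i σ ℕ.+ coverage i π ≡ 1

complementary? : (σ π : List (Subset n)) → Dec (Complementary σ π)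
complementary? σ π = Fin.all? (λ i → coverage i σ ℕ.+ coverage i π ℕ.≟ 1)

𝟙-complementary-shift : (B : Subset n) (σ π : List (Subset n)) →
  𝟙 (complementary? σ (B ∷ π)) ≡ 𝟙 (complementary? (B ∷ σ) π)
𝟙-complementary-shift B σ π =
  𝟙-cong (complementary? σ (B ∷ π)) (complementary? (B ∷ σ) π)
         (λ c i → trans (sym (shift i)) (c i)) (λ c i → trans (shift i) (c i))
  where
  lemma : ∀ a b c → a ℕ.+ (b ℕ.+ c) ≡ b ℕ.+ a ℕ.+ c
  lemma = ℕSolver.solve-∀
  shift : ∀ i → coverage i σ ℕ.+ coverage i (B ∷ π) ≡ coverage i (B ∷ σ) ℕ.+ coverage i π
  shift i rewrite coverage-∷ i B π | coverage-∷ i B σ =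
    lemma (coverage i σ) (coverage i (B ∷ [])) (coverage i π)

𝟙-complementary-⊥ : (σ π : List (Subset n)) → 𝟙 (complementary? (⊥ ∷ σ) π) ≡ 𝟙 (complementary? σ π)
𝟙-complementary-⊥ σ π =
  𝟙-cong (complementary? (⊥ ∷ σ) π) (complementary? σ π)
         (λ c i → trans (cong (ℕ._+ coverage i π) (sym (same i))) (c i))
         (λ c i → trans (cong (ℕ._+ coverage i π) (same i)) (c i))
  where
  same : ∀ i → coverage i (⊥ ∷ σ) ≡ coverage i σ
  same i = trans (coverage-∷ i ⊥ σ) (cong (ℕ._+ coverage i σ) (coverage-∉ (∉⊥ {x = i})))

-- A point of `B` is covered by the head of `B ∷ σ` and would be covered again by `π`, hence at
-- least twice.
complementary-disjoint : {B : Subset n} {σ π : List (Subset n)} →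
  Nonempty B → Complementary (B ∷ σ) π → ¬ (B ∈ˡ π)
complementary-disjoint {B = B} {σ} {π} (i , i∈B) c B∈π =
  ℕ.<⇒≢ {1} (ℕ.+-mono-≤ once (∈-length (∈-filter⁺ (i ∈?_) B∈π i∈B))) (sym (c i))
  where
  once : 1 ℕ.≤ coverage i (B ∷ σ)
  once = ∈-length (∈-filter⁺ (i ∈?_) {xs = B ∷ σ} (here refl) i∈B)

pairs : ℕ → ℕ
pairs k = (k * (k ∸ 1)) / 2

module _ (n : ℕ) (y : ℤ) where

  weight : List (Subset n) → ℤ
  weight π = y ^ s (map ∣_∣ π)

  weight-∷ : ∀ B π → weight (B ∷ π) ≡ weight (B ∷ []) ℤ.* weight π
  weight-∷ B π = trans
    (ℤ.^-distribˡ-+-* y (pairs ∣ B ∣) (s (map ∣_∣ π)))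
    (cong (λ k → y ^ k ℤ.* weight π) (sym (ℕ.+-identityʳ (pairs ∣ B ∣))))

  tupleSum : ℕ → List (Subset n) → ℤ
  tupleSum q σ = ∑ (words q (subsets n)) (λ M → 𝟙 (complementary? σ (toList M)) ℤ.* weight (toList M))

  mass : (σ π : List (Subset n)) → ℤ
  mass σ π = 𝟙 (All.all? nonempty? π) ℤ.* (𝟙 (complementary? σ π) ℤ.* weight π)

  -- For x = q the falling factorial counts the ways to give the blocks distinct colours, that is,
  -- to place them in a q-tuple whose other entries are empty.
  familySum : ℤ → List (Subset n) → ℤ
  familySum x σ = ∑ (sublists (subsets n)) (λ π → falling x (length π) ℤ.* mass σ π)

  mass-resp-↭ : ∀ σ {π π′} → π ↭ π′ → mass σ π ≡ mass σ π′
  mass-resp-↭ σ {π} {π′} p = cong₂ ℤ._*_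
    (𝟙-cong (All.all? nonempty? π) (All.all? nonempty? π′) (All-resp-↭ p) (All-resp-↭ (↭-sym p)))
    (cong₂ ℤ._*_
      (𝟙-cong (complementary? σ π) (complementary? σ π′)
        (λ c i → trans (cong (ℕ._+_ (coverage i σ)) (sym (same i))) (c i))
        (λ c i → trans (cong (ℕ._+_ (coverage i σ)) (same i)) (c i)))
      (cong (y ^_) (sum-↭ (↭-map⁺ _ (↭-map⁺ ∣_∣ p)))))
    where
    same : ∀ i → coverage i π ≡ coverage i π′
    same i = ↭-length (filter-↭ (i ∈?_) p)

  mass-∷ : ∀ σ B π → mass σ (B ∷ π) ≡ 𝟙 (nonempty? B) ℤ.* (weight (B ∷ []) ℤ.* mass (B ∷ σ) π)
  mass-∷ σ B π = begin
    𝟙 (All.all? nonempty? (B ∷ π)) ℤ.* (𝟙 (complementary? σ (B ∷ π)) ℤ.* weight (B ∷ π))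
      ≡⟨ cong₂ ℤ._*_
           (trans (𝟙-cong (All.all? nonempty? (B ∷ π)) (nonempty? B ×-dec All.all? nonempty? π)
                          (λ { (b ∷ bs) → b , bs }) (λ (b , bs) → b ∷ bs))
                  (𝟙-× (nonempty? B) (All.all? nonempty? π)))
           (cong₂ ℤ._*_ (𝟙-complementary-shift B σ π) (weight-∷ B π)) ⟩
    𝟙 (nonempty? B) ℤ.* 𝟙 (All.all? nonempty? π) ℤ.*
    (𝟙 (complementary? (B ∷ σ) π) ℤ.* (weight (B ∷ []) ℤ.* weight π))
      ≡⟨ lemma (𝟙 (nonempty? B)) (𝟙 (All.all? nonempty? π)) (𝟙 (complementary? (B ∷ σ) π)) (weight (B ∷ [])) (weight π) ⟩
    𝟙 (nonempty? B) ℤ.* (weight (B ∷ []) ℤ.* mass (B ∷ σ) π) ∎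
    where
    open ≡-Reasoning
    lemma : ∀ a b c d e → a ℤ.* b ℤ.* (c ℤ.* (d ℤ.* e)) ≡ a ℤ.* (d ℤ.* (b ℤ.* (c ℤ.* e)))
    lemma = solve-∀

  mass-⊥ : ∀ σ π → mass (⊥ ∷ σ) π ≡ mass σ π
  mass-⊥ σ π = cong (λ d → 𝟙 (All.all? nonempty? π) ℤ.* (d ℤ.* weight π)) (𝟙-complementary-⊥ σ π)

  -- Provides the vanishing that `∑-picks-swap` asks for.
  mass-vanishes : ∀ σ {B π} → B ∈ˡ π → 𝟙 (nonempty? B) ℤ.* mass (B ∷ σ) π ≡ 0ℤ
  mass-vanishes σ {B} {π} B∈π with nonempty? B
  ... | no _   = refl
  ... | yes ne = begin
    1ℤ ℤ.* mass (B ∷ σ) π                                          ≡⟨ ℤ.*-identityˡ (mass (B ∷ σ) π) ⟩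
    𝟙 (All.all? nonempty? π) ℤ.* (𝟙 (complementary? (B ∷ σ) π) ℤ.* weight π)
      ≡⟨ cong (λ d → 𝟙 (All.all? nonempty? π) ℤ.* (d ℤ.* weight π))
              (𝟙-no (complementary? (B ∷ σ) π) (λ c → complementary-disjoint ne c B∈π)) ⟩
    𝟙 (All.all? nonempty? π) ℤ.* (0ℤ ℤ.* weight π)                 ≡⟨ ℤ.*-zeroʳ (𝟙 (All.all? nonempty? π)) ⟩
    0ℤ                                                             ∎
    where open ≡-Reasoning

  -- In (1+x)_k = (x)_k + k (x)_{k-1} the last term marks one block, the colour
  -- class of the additional colour.

  familySum-step : ∀ x σ → familySum (1ℤ ℤ.+ x) σ ≡
    familySum x σ ℤ.+ ∑ (subsets n) (λ B → 𝟙 (nonempty? B) ℤ.* (weight (B ∷ []) ℤ.* familySum x (B ∷ σ)))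
  familySum-step x σ = begin
    ∑ S (λ π → falling (1ℤ ℤ.+ x) (length π) ℤ.* mass σ π)
      ≡⟨ ∑-cong S (λ π → trans (cong (ℤ._* mass σ π) (falling-difference x (length π)))
                               (lemma₁ (falling x (length π)) (+ length π) (falling x (ℕ.pred (length π))) (mass σ π))) ⟩
    ∑ S (λ π → falling x (length π) ℤ.* mass σ π ℤ.+ + length π ℤ.* h π)
      ≡⟨ ∑-+ S (λ π → falling x (length π) ℤ.* mass σ π) (λ π → + length π ℤ.* h π) ⟩
    familySum x σ ℤ.+ ∑ S (λ π → + length π ℤ.* h π)
      ≡⟨ cong (ℤ._+_ (familySum x σ)) (begin
           ∑ S (λ π → + length π ℤ.* h π)
             ≡⟨ ∑-cong S (λ π → sym (∑-picks h h-resp-↭ π)) ⟩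
           ∑ S (λ π → ∑ (picks π) (λ (B , π′) → h (B ∷ π′)))
             ≡⟨ ∑-cong S (λ π → ∑-cong (picks π) (λ (B , π′) → h-∷ B π′)) ⟩
           ∑ S (λ π → ∑ (picks π) (uncurry g))
             ≡⟨ ∑-picks-swap (subsets n) g g-vanishes ⟩
           ∑ (subsets n) (λ B → ∑ S (g B))
             ≡⟨ ∑-cong (subsets n) (λ B → factor B) ⟩
           ∑ (subsets n) (λ B → 𝟙 (nonempty? B) ℤ.* (weight (B ∷ []) ℤ.* familySum x (B ∷ σ))) ∎) ⟩
    familySum x σ ℤ.+ ∑ (subsets n) (λ B → 𝟙 (nonempty? B) ℤ.* (weight (B ∷ []) ℤ.* familySum x (B ∷ σ))) ∎
    where
    open ≡-Reasoning
    S : List (List (Subset n))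
    S = sublists (subsets n)

    h : List (Subset n) → ℤ
    h π = falling x (ℕ.pred (length π)) ℤ.* mass σ π

    h-resp-↭ : ∀ {π π′} → π ↭ π′ → h π ≡ h π′
    h-resp-↭ p = cong₂ (λ k m → falling x (ℕ.pred k) ℤ.* m) (↭-length p) (mass-resp-↭ σ p)

    g : Subset n → List (Subset n) → ℤ
    g B π = weight (B ∷ []) ℤ.* falling x (length π) ℤ.* (𝟙 (nonempty? B) ℤ.* mass (B ∷ σ) π)

    g-vanishes : ∀ {B π} → B ∈ˡ π → g B π ≡ 0ℤ
    g-vanishes {B} {π} B∈π =
      trans (cong (ℤ._*_ (weight (B ∷ []) ℤ.* falling x (length π))) (mass-vanishes σ B∈π))
            (ℤ.*-zeroʳ (weight (B ∷ []) ℤ.* falling x (length π)))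

    h-∷ : ∀ B π → h (B ∷ π) ≡ g B π
    h-∷ B π = trans (cong (ℤ._*_ (falling x (length π))) (mass-∷ σ B π))
                    (lemma₂ (falling x (length π)) (𝟙 (nonempty? B)) (weight (B ∷ [])) (mass (B ∷ σ) π))
      where
      lemma₂ : ∀ a b c d → a ℤ.* (b ℤ.* (c ℤ.* d)) ≡ c ℤ.* a ℤ.* (b ℤ.* d)
      lemma₂ = solve-∀

    factor : ∀ B → ∑ S (g B) ≡ 𝟙 (nonempty? B) ℤ.* (weight (B ∷ []) ℤ.* familySum x (B ∷ σ))
    factor B = begin
      ∑ S (g B)
        ≡⟨ ∑-cong S (λ π → lemma₃ (weight (B ∷ [])) (falling x (length π)) (𝟙 (nonempty? B)) (mass (B ∷ σ) π)) ⟩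
      ∑ S (λ π → 𝟙 (nonempty? B) ℤ.* weight (B ∷ []) ℤ.* (falling x (length π) ℤ.* mass (B ∷ σ) π))
        ≡⟨ ∑-*ˡ S (𝟙 (nonempty? B) ℤ.* weight (B ∷ [])) _ ⟩
      𝟙 (nonempty? B) ℤ.* weight (B ∷ []) ℤ.* familySum x (B ∷ σ)
        ≡⟨ ℤ.*-assoc (𝟙 (nonempty? B)) (weight (B ∷ [])) (familySum x (B ∷ σ)) ⟩
      𝟙 (nonempty? B) ℤ.* (weight (B ∷ []) ℤ.* familySum x (B ∷ σ)) ∎
      where
      lemma₃ : ∀ a b c d → a ℤ.* b ℤ.* (c ℤ.* d) ≡ c ℤ.* a ℤ.* (b ℤ.* d)
      lemma₃ = solve-∀

    lemma₁ : ∀ a k b m → (a ℤ.+ k ℤ.* b) ℤ.* m ≡ a ℤ.* m ℤ.+ k ℤ.* (b ℤ.* m)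
    lemma₁ = solve-∀

  weight-⊥ : weight (⊥ ∷ []) ≡ 1ℤ
  weight-⊥ rewrite ∣⊥∣≡0 n = refl

  -- The separate summand `familySum x σ` is the term of the empty class: `⊥` has weight 1 and
  -- covers nothing. With it the sum runs over all subsets, as it does for tuples.
  familySum-step′ : ∀ x σ → familySum (1ℤ ℤ.+ x) σ ≡
    ∑ (subsets n) (λ B → weight (B ∷ []) ℤ.* familySum x (B ∷ σ))
  familySum-step′ x σ = begin
    familySum (1ℤ ℤ.+ x) σ
      ≡⟨ familySum-step x σ ⟩
    familySum x σ ℤ.+ ∑ (subsets n) (λ B → 𝟙 (nonempty? B) ℤ.* g B)
      ≡⟨ cong (ℤ._+ ∑ (subsets n) (λ B → 𝟙 (nonempty? B) ℤ.* g B)) (sym (trans (∑-empty n g) at-⊥)) ⟩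
    ∑ (subsets n) (λ B → (1ℤ ℤ.- 𝟙 (nonempty? B)) ℤ.* g B) ℤ.+ ∑ (subsets n) (λ B → 𝟙 (nonempty? B) ℤ.* g B)
      ≡⟨ ∑-+ (subsets n) (λ B → (1ℤ ℤ.- 𝟙 (nonempty? B)) ℤ.* g B) (λ B → 𝟙 (nonempty? B) ℤ.* g B) ⟨
    ∑ (subsets n) (λ B → (1ℤ ℤ.- 𝟙 (nonempty? B)) ℤ.* g B ℤ.+ 𝟙 (nonempty? B) ℤ.* g B)
      ≡⟨ ∑-cong (subsets n) (λ B → lemma (𝟙 (nonempty? B)) (g B)) ⟩
    ∑ (subsets n) g ∎
    where
    open ≡-Reasoning
    g : Subset n → ℤ
    g B = weight (B ∷ []) ℤ.* familySum x (B ∷ σ)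
    at-⊥ : g ⊥ ≡ familySum x σ
    at-⊥ = trans (cong₂ ℤ._*_ weight-⊥ (∑-cong (sublists (subsets n)) (λ π → cong (ℤ._*_ (falling x (length π))) (mass-⊥ σ π))))
                 (ℤ.*-identityˡ (familySum x σ))
    lemma : ∀ d x → (1ℤ ℤ.- d) ℤ.* x ℤ.+ d ℤ.* x ≡ x
    lemma = solve-∀

  tupleSum-step : ∀ q σ → tupleSum (suc q) σ ≡ ∑ (subsets n) (λ B → weight (B ∷ []) ℤ.* tupleSum q (B ∷ σ))
  tupleSum-step q σ = begin
    tupleSum (suc q) σ
      ≡⟨ ∑-words-suc q (subsets n) _ ⟩
    ∑ (subsets n) (λ B → ∑ Ms (λ M → 𝟙 (complementary? σ (B ∷ toList M)) ℤ.* weight (B ∷ toList M)))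
      ≡⟨ ∑-cong (subsets n) (λ B → trans (∑-cong Ms (λ M → trans
           (cong₂ ℤ._*_ (𝟙-complementary-shift B σ (toList M)) (weight-∷ B (toList M)))
           (lemma (𝟙 (complementary? (B ∷ σ) (toList M))) (weight (B ∷ [])) (weight (toList M)))))
           (∑-*ˡ Ms (weight (B ∷ [])) _)) ⟩
    ∑ (subsets n) (λ B → weight (B ∷ []) ℤ.* tupleSum q (B ∷ σ)) ∎
    where
    open ≡-Reasoning
    Ms = words q (subsets n)
    lemma : ∀ a b c → a ℤ.* (b ℤ.* c) ≡ b ℤ.* (a ℤ.* c)
    lemma = solve-∀

  falling-0-suc : ∀ k → falling 0ℤ (suc k) ≡ 0ℤ
  falling-0-suc zero    = refl
  falling-0-suc (suc k) = trans (cong (ℤ._* (0ℤ ℤ.- + suc k)) (falling-0-suc k)) refl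

  -- At x = 0 the falling factorial of every positive length has a factor zero.
  familySum-0 : ∀ σ → familySum 0ℤ σ ≡ mass σ []
  familySum-0 σ = go (subsets n)
    where
    open ≡-Reasoning
    t : List (Subset n) → ℤ
    t π = falling 0ℤ (length π) ℤ.* mass σ π
    go : ∀ Bs → ∑ (sublists Bs) t ≡ mass σ []
    go []       = trans (ℤ.+-identityʳ (t [])) (ℤ.*-identityˡ (mass σ []))
    go (B ∷ Bs) = begin
      ∑ (sublists (B ∷ Bs)) t                                       ≡⟨ ∑-sublists-∷ B Bs t ⟩
      ∑ (sublists Bs) (λ π → t (B ∷ π)) ℤ.+ ∑ (sublists Bs) t       ≡⟨ cong₂ ℤ._+_ killed (go Bs) ⟩
      0ℤ ℤ.+ mass σ []                                              ≡⟨ ℤ.+-identityˡ (mass σ []) ⟩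
      mass σ []                                                     ∎
      where
      killed : ∑ (sublists Bs) (λ π → t (B ∷ π)) ≡ 0ℤ
      killed = trans (∑-cong (sublists Bs) (λ π → cong (ℤ._* mass σ (B ∷ π)) (falling-0-suc (length π))))
                     (∑-0 (sublists Bs))

  -- Both sides obey the same recurrence in `q`. The induction hypothesis is needed at `B ∷ σ`, so
  -- `σ` has to vary.
  tupleSum≡familySum : ∀ q σ → tupleSum q σ ≡ familySum (+ q) σ
  tupleSum≡familySum zero    σ = begin
    𝟙 (complementary? σ []) ℤ.* 1ℤ ℤ.+ 0ℤ   ≡⟨ ℤ.+-identityʳ (𝟙 (complementary? σ []) ℤ.* 1ℤ) ⟩
    𝟙 (complementary? σ []) ℤ.* 1ℤ          ≡⟨ ℤ.*-identityˡ (𝟙 (complementary? σ []) ℤ.* 1ℤ) ⟨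
    mass σ []                               ≡⟨ familySum-0 σ ⟨
    familySum 0ℤ σ                          ∎
    where open ≡-Reasoning
  tupleSum≡familySum (suc q) σ = begin
    tupleSum (suc q) σ                                                       ≡⟨ tupleSum-step q σ ⟩
    ∑ (subsets n) (λ B → weight (B ∷ []) ℤ.* tupleSum q (B ∷ σ))
      ≡⟨ ∑-cong (subsets n) (λ B → cong (ℤ._*_ (weight (B ∷ []))) (tupleSum≡familySum q (B ∷ σ))) ⟩
    ∑ (subsets n) (λ B → weight (B ∷ []) ℤ.* familySum (+ q) (B ∷ σ))        ≡⟨ familySum-step′ (+ q) σ ⟨
    familySum (+ suc q) σ                                                    ∎
    where open ≡-Reasoning

-- Colourings of the complete graph

-- A tuple of `q` rows of length `suc n` is a matrix, and `b` is its first column. For subsets the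
-- column records which classes contain the vertex `zero`.
∑-words-transpose : ∀ q n (xs : List A) (g : Vec (Vec A (suc n)) q → ℤ) →
  ∑ (words q (words (suc n) xs)) g ≡
  ∑ (words q xs) (λ b → ∑ (words q (words n xs)) (λ M → g (zipWith _∷_ b M)))
∑-words-transpose zero    n xs g = cong (ℤ._+ 0ℤ) (sym (ℤ.+-identityʳ (g [])))
∑-words-transpose (suc q) n xs g = begin
  ∑ (words (suc q) (words (suc n) xs)) g
    ≡⟨ ∑-words-suc q (words (suc n) xs) g ⟩
  ∑ (words (suc n) xs) (λ r → ∑ (words q (words (suc n) xs)) (λ M → g (r ∷ M)))
    ≡⟨ ∑-words-suc n xs _ ⟩
  ∑ xs (λ x → ∑ (words n xs) (λ r → ∑ (words q (words (suc n) xs)) (λ M → g ((x ∷ r) ∷ M))))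
    ≡⟨ ∑-cong xs (λ x → ∑-cong (words n xs) (λ r → ∑-words-transpose q n xs (λ M → g ((x ∷ r) ∷ M)))) ⟩
  ∑ xs (λ x → ∑ (words n xs) (λ r → ∑ (words q xs) (λ b →
    ∑ (words q (words n xs)) (λ M → g ((x ∷ r) ∷ zipWith _∷_ b M)))))
    ≡⟨ ∑-cong xs (λ x → ∑-swap (words n xs) (words q xs) _) ⟩
  ∑ xs (λ x → ∑ (words q xs) (λ b → ∑ (words n xs) (λ r →
    ∑ (words q (words n xs)) (λ M → g ((x ∷ r) ∷ zipWith _∷_ b M)))))
    ≡⟨ ∑-cong xs (λ x → ∑-cong (words q xs) (λ b →
         sym (∑-words-suc q (words n xs) (λ M → g (zipWith _∷_ (x ∷ b) M))))) ⟩
  ∑ xs (λ x → ∑ (words q xs) (λ b → ∑ (words (suc q) (words n xs)) (λ M → g (zipWith _∷_ (x ∷ b) M))))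
    ≡⟨ ∑-words-suc q xs (λ b → ∑ (words (suc q) (words n xs)) (λ M → g (zipWith _∷_ b M))) ⟨
  ∑ (words (suc q) xs) (λ b → ∑ (words (suc q) (words n xs)) (λ M → g (zipWith _∷_ b M))) ∎
  where open ≡-Reasoning

∑-words-singleton : ∀ q (x : A) (g : Vec A q → ℤ) → ∑ (words q (x ∷ [])) g ≡ g (Vec.replicate q x)
∑-words-singleton zero    x g = ℤ.+-identityʳ (g [])
∑-words-singleton (suc q) x g =
  trans (∑-words-suc q (x ∷ []) g)
        (trans (ℤ.+-identityʳ _) (∑-words-singleton q x (λ w → g (x ∷ w))))

∑-size-0 : ∀ n (g : Subset n → ℤ) → ∑ (subsets n) (λ B → 𝟙 (∣ B ∣ ℕ.≟ 0) ℤ.* g B) ≡ g ⊥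
∑-size-0 zero    g = trans (ℤ.+-identityʳ (1ℤ ℤ.* g [])) (ℤ.*-identityˡ (g []))
∑-size-0 (suc n) g = begin
  ∑ (subsets (suc n)) (λ B → 𝟙 (∣ B ∣ ℕ.≟ 0) ℤ.* g B)                  ≡⟨ ∑-subsets-suc n _ ⟩
  ∑ (subsets n) (λ _ → 0ℤ) ℤ.+ ∑ (subsets n) (λ B → 𝟙 (∣ B ∣ ℕ.≟ 0) ℤ.* g (outside ∷ B))
    ≡⟨ cong₂ ℤ._+_ (∑-0 (subsets n)) (∑-size-0 n (λ B → g (outside ∷ B))) ⟩
  0ℤ ℤ.+ g ⊥                                                            ≡⟨ ℤ.+-identityˡ (g ⊥) ⟩
  g ⊥                                                                   ∎
  where open ≡-Reasoning

-- Applied to the column of a vertex: having size 1 means that the vertex lies in just one class,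
-- and the index of that class is its colour.
∑-size-1 : ∀ n (g : Subset n → ℤ) →
  ∑ (subsets n) (λ B → 𝟙 (∣ B ∣ ℕ.≟ 1) ℤ.* g B) ≡ ∑ (allFin n) (λ i → g ⁅ i ⁆)
∑-size-1 zero    g = refl
∑-size-1 (suc n) g = begin
  ∑ (subsets (suc n)) (λ B → 𝟙 (∣ B ∣ ℕ.≟ 1) ℤ.* g B)
    ≡⟨ ∑-subsets-suc n _ ⟩
  ∑ (subsets n) (λ B → 𝟙 (∣ B ∣ ℕ.≟ 0) ℤ.* g (inside ∷ B)) ℤ.+
  ∑ (subsets n) (λ B → 𝟙 (∣ B ∣ ℕ.≟ 1) ℤ.* g (outside ∷ B))
    ≡⟨ cong₂ ℤ._+_ (∑-size-0 n (λ B → g (inside ∷ B))) (∑-size-1 n (λ B → g (outside ∷ B))) ⟩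
  g ⁅ zero ⁆ ℤ.+ ∑ (allFin n) (λ i → g ⁅ suc i ⁆)
    ≡⟨ ∑-allFin-suc n (λ i → g ⁅ i ⁆) ⟨
  ∑ (allFin (suc n)) (λ i → g ⁅ i ⁆) ∎
  where open ≡-Reasoning

-- Built one vertex, that is one column, at a time, to fit `∑-words-transpose`.
classes : Vec (Fin q) n → Vec (Subset n) q
classes {q} []      = Vec.replicate q []
classes     (a ∷ c) = zipWith _∷_ ⁅ a ⁆ (classes c)

coverage-zero : (b : Subset q) (M : Vec (Subset n) q) → coverage zero (toList (zipWith _∷_ b M)) ≡ ∣ b ∣
coverage-zero []            []      = refl
coverage-zero (inside ∷ b)  (_ ∷ M) = cong suc (coverage-zero b M)
coverage-zero (outside ∷ b) (_ ∷ M) = coverage-zero b M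

coverage-suc : (i : Fin n) (b : Subset q) (M : Vec (Subset n) q) →
  coverage (suc i) (toList (zipWith _∷_ b M)) ≡ coverage i (toList M)
coverage-suc i []      []      = refl
coverage-suc i (x ∷ b) (B ∷ M) with i ∈? B
... | yes _ = cong suc (coverage-suc i b M)
... | no _  = coverage-suc i b M

𝟙-complementary-zipWith : (b : Subset q) (M : Vec (Subset n) q) →
  𝟙 (complementary? [] (toList (zipWith _∷_ b M))) ≡ 𝟙 (∣ b ∣ ℕ.≟ 1) ℤ.* 𝟙 (complementary? [] (toList M))
𝟙-complementary-zipWith b M = trans
  (𝟙-cong (complementary? [] (toList (zipWith _∷_ b M))) (∣ b ∣ ℕ.≟ 1 ×-dec complementary? [] (toList M))
    (λ c → trans (sym (coverage-zero b M)) (c zero) , λ i → trans (sym (coverage-suc i b M)) (c (suc i)))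
    λ { (c , cs) zero → trans (coverage-zero b M) c ; (c , cs) (suc i) → trans (coverage-suc i b M) (cs i) })
  (𝟙-× (∣ b ∣ ℕ.≟ 1) (complementary? [] (toList M)))

∑-classes : ∀ q n (g : Vec (Subset n) q → ℤ) →
  ∑ (words q (subsets n)) (λ M → 𝟙 (complementary? [] (toList M)) ℤ.* g M) ≡
  ∑ (words n (allFin q)) (λ c → g (classes c))
∑-classes q zero    g = begin
  ∑ (words q ([] ∷ [])) (λ M → 𝟙 (complementary? [] (toList M)) ℤ.* g M)
    ≡⟨ ∑-words-singleton q [] _ ⟩
  1ℤ ℤ.* g (Vec.replicate q [])      ≡⟨ ℤ.*-identityˡ (g (Vec.replicate q [])) ⟩
  g (Vec.replicate q [])             ≡⟨ ℤ.+-identityʳ (g (Vec.replicate q [])) ⟨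
  g (Vec.replicate q []) ℤ.+ 0ℤ      ∎
  where open ≡-Reasoning
∑-classes q (suc n) g = begin
  ∑ (words q (subsets (suc n))) (λ M → 𝟙 (complementary? [] (toList M)) ℤ.* g M)
    ≡⟨ ∑-words-transpose q n (true ∷ false ∷ []) _ ⟩
  ∑ (subsets q) (λ b → ∑ Ms (λ M → 𝟙 (complementary? [] (toList (zipWith _∷_ b M))) ℤ.* g (zipWith _∷_ b M)))
    ≡⟨ ∑-cong (subsets q) (λ b → trans
         (∑-cong Ms (λ M → trans (cong (ℤ._* g (zipWith _∷_ b M)) (𝟙-complementary-zipWith b M))
                                 (ℤ.*-assoc (𝟙 (∣ b ∣ ℕ.≟ 1)) (𝟙 (complementary? [] (toList M))) (g (zipWith _∷_ b M)))))
         (trans (∑-*ˡ Ms (𝟙 (∣ b ∣ ℕ.≟ 1)) _)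
                (cong (ℤ._*_ (𝟙 (∣ b ∣ ℕ.≟ 1))) (∑-classes q n (λ M → g (zipWith _∷_ b M)))))) ⟩
  ∑ (subsets q) (λ b → 𝟙 (∣ b ∣ ℕ.≟ 1) ℤ.* ∑ (words n (allFin q)) (λ c → g (zipWith _∷_ b (classes c))))
    ≡⟨ ∑-size-1 q _ ⟩
  ∑ (allFin q) (λ a → ∑ (words n (allFin q)) (λ c → g (classes (a ∷ c))))
    ≡⟨ ∑-words-suc n (allFin q) (λ c → g (classes c)) ⟨
  ∑ (words (suc n) (allFin q)) (λ c → g (classes c)) ∎
  where
  open ≡-Reasoning
  Ms = words q (subsets n)

-- Edges of the complete graph and pairs within classes

pairs-suc : ∀ k → pairs (suc k) ≡ k ℕ.+ pairs k
pairs-suc zero    = refl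
pairs-suc (suc j) = begin
  (suc (suc j) * suc j) / 2                   ≡⟨ cong (_/ 2) (lemma j) ⟩
  -- Truncated halving is not additive in general; it splits here because `suc j * 2` is a multiple
  -- of 2.
  (suc j * 2 ℕ.+ suc j * j) / 2               ≡⟨ +-distrib-/-∣ˡ (suc j * j) (divides (suc j) refl) ⟩
  (suc j * 2) / 2 ℕ.+ (suc j * j) / 2         ≡⟨ cong (ℕ._+ (suc j * j) / 2) (m*n/n≡m (suc j) 2) ⟩
  suc j ℕ.+ pairs (suc j)                     ∎
  where
  open ≡-Reasoning
  lemma : ∀ j → suc (suc j) * suc j ≡ suc j * 2 ℕ.+ suc j * j
  lemma = ℕSolver.solve-∀

completeEdges : ∀ n → List (Fin n × Fin n)
completeEdges n = filter (uncurry Fin._<?_) (cartesianProduct (allFin n) (allFin n))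

∑-completeEdges : ∀ n (g : Fin n → Fin n → ℤ) →
  ∑ (completeEdges n) (uncurry g) ≡ ∑ (allFin n) (λ u → ∑ (allFin n) (λ v → 𝟙 (u Fin.<? v) ℤ.* g u v))
∑-completeEdges n g =
  trans (∑-filter (uncurry Fin._<?_) (cartesianProduct (allFin n) (allFin n)) (uncurry g))
        (∑-cartesianProductWith _,_ (allFin n) (allFin n) _)

-- No pair u < v has v = `zero`, and u = `zero` leaves every `suc v` free. Stated for sums, since
-- the double sum splits at `zero`; the number of edges and the number of monochromatic edges are
-- both obtained this way.
∑-completeEdges-suc : ∀ n (g : Fin (suc n) → Fin (suc n) → ℤ) →
  ∑ (completeEdges (suc n)) (uncurry g) ≡
  ∑ (allFin n) (λ v → g zero (suc v)) ℤ.+ ∑ (completeEdges n) (λ (u , v) → g (suc u) (suc v))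
∑-completeEdges-suc n g = begin
  ∑ (completeEdges (suc n)) (uncurry g)
    ≡⟨ ∑-completeEdges (suc n) g ⟩
  ∑ (allFin (suc n)) (λ u → ∑ (allFin (suc n)) (h u))
    ≡⟨ trans (∑-allFin-suc n (λ u → ∑ (allFin (suc n)) (h u)))
             (cong₂ ℤ._+_ (∑-allFin-suc n (h zero)) (∑-cong (allFin n) (λ u → ∑-allFin-suc n (h (suc u))))) ⟩
  h zero zero ℤ.+ ∑ (allFin n) (λ v → h zero (suc v)) ℤ.+
  ∑ (allFin n) (λ u → h (suc u) zero ℤ.+ ∑ (allFin n) (λ v → h (suc u) (suc v)))
    ≡⟨ cong₂ ℤ._+_
         (trans (ℤ.+-identityˡ (∑ (allFin n) (λ v → h zero (suc v))))
                (∑-cong (allFin n) (λ v → ℤ.*-identityˡ (g zero (suc v)))))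
         (trans (∑-cong (allFin n) (λ u → trans (ℤ.+-identityˡ (∑ (allFin n) (λ v → h (suc u) (suc v)))) (∑-cong (allFin n) (λ v →
                   cong (ℤ._* g (suc u) (suc v))
                        (𝟙-cong (suc u Fin.<? suc v) (u Fin.<? v) ℕ.s<s⁻¹ ℕ.s<s)))))
                (sym (∑-completeEdges n (λ u v → g (suc u) (suc v))))) ⟩
  ∑ (allFin n) (λ v → g zero (suc v)) ℤ.+ ∑ (completeEdges n) (λ (u , v) → g (suc u) (suc v)) ∎
  where
  open ≡-Reasoning
  h : Fin (suc n) → Fin (suc n) → ℤ
  h u v = 𝟙 (u Fin.<? v) ℤ.* g u v

length-completeEdges : ∀ n → length (completeEdges n) ≡ pairs n
length-completeEdges n = ℤ.+-injective (begin
  + length (completeEdges n)             ≡⟨ ℤ.*-identityʳ (+ length (completeEdges n)) ⟨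
  + length (completeEdges n) ℤ.* 1ℤ      ≡⟨ ∑-const (completeEdges n) 1ℤ ⟨
  ∑ (completeEdges n) (λ _ → 1ℤ)         ≡⟨ go n ⟩
  + pairs n                              ∎)
  where
  open ≡-Reasoning
  go : ∀ n → ∑ (completeEdges n) (λ _ → 1ℤ) ≡ + pairs n
  go zero    = refl
  go (suc n) = begin
    ∑ (completeEdges (suc n)) (λ _ → 1ℤ)                            ≡⟨ ∑-completeEdges-suc n (λ _ _ → 1ℤ) ⟩
    ∑ (allFin n) (λ _ → 1ℤ) ℤ.+ ∑ (completeEdges n) (λ _ → 1ℤ)      ≡⟨ cong₂ ℤ._+_ (trans (∑-allFin-const n 1ℤ) (ℤ.*-identityʳ (+ n))) (go n) ⟩
    + n ℤ.+ + pairs n                                               ≡⟨ cong +_ (pairs-suc n) ⟨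
    + pairs (suc n)                                                 ∎

∣⁅⁆∷∣ : (a b : Fin q) (B : Subset n) → + ∣ lookup ⁅ b ⁆ a ∷ B ∣ ≡ 𝟙 (a Fin.≟ b) ℤ.+ + ∣ B ∣
∣⁅⁆∷∣ zero    zero    B = refl
∣⁅⁆∷∣ zero    (suc b) B = refl
∣⁅⁆∷∣ (suc a) zero    B rewrite lookup-replicate a outside = refl
∣⁅⁆∷∣ (suc a) (suc b) B = ∣⁅⁆∷∣ a b B

size-class : (c : Vec (Fin q) n) (a : Fin q) →
  + ∣ lookup (classes c) a ∣ ≡ ∑ (allFin n) (λ v → 𝟙 (a Fin.≟ lookup c v))
size-class             []      a = cong (λ B → + ∣ B ∣) (lookup-replicate a [])
size-class {n = suc n} (b ∷ c) a = begin
  + ∣ lookup (zipWith _∷_ ⁅ b ⁆ (classes c)) a ∣          ≡⟨ cong (λ B → + ∣ B ∣) (lookup-zipWith _∷_ a ⁅ b ⁆ (classes c)) ⟩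
  + ∣ lookup ⁅ b ⁆ a ∷ lookup (classes c) a ∣             ≡⟨ ∣⁅⁆∷∣ a b (lookup (classes c) a) ⟩
  𝟙 (a Fin.≟ b) ℤ.+ + ∣ lookup (classes c) a ∣            ≡⟨ cong (ℤ._+_ (𝟙 (a Fin.≟ b))) (size-class c a) ⟩
  𝟙 (a Fin.≟ b) ℤ.+ ∑ (allFin n) (λ v → 𝟙 (a Fin.≟ lookup c v))
    ≡⟨ ∑-allFin-suc n (λ v → 𝟙 (a Fin.≟ lookup (b ∷ c) v)) ⟨
  ∑ (allFin (suc n)) (λ v → 𝟙 (a Fin.≟ lookup (b ∷ c) v)) ∎
  where open ≡-Reasoning

s-⊥ : (M : Vec (Subset n) q) → s (map ∣_∣ (toList (zipWith _∷_ ⊥ M))) ≡ s (map ∣_∣ (toList M))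
s-⊥ []      = refl
s-⊥ (B ∷ M) = cong (ℕ._+_ (pairs ∣ B ∣)) (s-⊥ M)

-- The new vertex forms one new pair with each old member of class `a`.
s-⁅⁆ : (a : Fin q) (M : Vec (Subset n) q) →
  s (map ∣_∣ (toList (zipWith _∷_ ⁅ a ⁆ M))) ≡ ∣ lookup M a ∣ ℕ.+ s (map ∣_∣ (toList M))
s-⁅⁆ zero    (B ∷ M) = trans (cong₂ ℕ._+_ (pairs-suc ∣ B ∣) (s-⊥ M)) (ℕ.+-assoc ∣ B ∣ _ _)
s-⁅⁆ (suc a) (B ∷ M) = trans (cong (ℕ._+_ (pairs ∣ B ∣)) (s-⁅⁆ a M)) (lemma (pairs ∣ B ∣) ∣ lookup M a ∣ _)
  where
  lemma : ∀ a b c → a ℕ.+ (b ℕ.+ c) ≡ b ℕ.+ (a ℕ.+ c)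
  lemma = ℕSolver.solve-∀

monochromatic? : (c : Vec (Fin q) n) → ((u , v) : Fin n × Fin n) → Dec (lookup c u ≡ lookup c v)
monochromatic? c (u , v) = lookup c u Fin.≟ lookup c v

-- Induction on the vertices: the vertex `zero` adds one monochromatic edge for each later vertex of
-- its colour, and `s` grows by the size of that class.
s-classes : (c : Vec (Fin q) n) →
  length (filter (monochromatic? c) (completeEdges n)) ≡ s (map ∣_∣ (toList (classes c)))
s-classes {n = n} c = ℤ.+-injective (trans (length-filter-∑ (monochromatic? c) (completeEdges n)) (go c))
  where
  open ≡-Reasoning
  empty : ∀ q → 0ℤ ≡ + s (map ∣_∣ (toList (Vec.replicate q ([] {A = Bool}))))
  empty zero    = refl
  empty (suc q) = empty q
  go : ∀ {n} (c : Vec (Fin q) n) →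
    ∑ (completeEdges n) (λ e → 𝟙 (monochromatic? c e)) ≡ + s (map ∣_∣ (toList (classes c)))
  go {q = q} [] = empty q
  go {n = suc n} (a ∷ c) = begin
    ∑ (completeEdges (suc n)) (λ e → 𝟙 (monochromatic? (a ∷ c) e))
      ≡⟨ ∑-completeEdges-suc n (λ u v → 𝟙 (monochromatic? (a ∷ c) (u , v))) ⟩
    ∑ (allFin n) (λ v → 𝟙 (a Fin.≟ lookup c v)) ℤ.+ ∑ (completeEdges n) (λ e → 𝟙 (monochromatic? c e))
      ≡⟨ cong₂ ℤ._+_ (sym (size-class c a)) (go c) ⟩
    + ∣ lookup (classes c) a ∣ ℤ.+ + s (map ∣_∣ (toList (classes c)))
      ≡⟨ cong +_ (s-⁅⁆ a (classes c)) ⟨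
    + s (map ∣_∣ (toList (classes (a ∷ c)))) ∎

-- The factor of an edge is q - 1 = -(1 - q) if it is monochromatic and -1 otherwise, so every edge
-- gives a sign and only monochromatic ones give 1 - q.
colourWeight-fromList : (c : Vec (Fin q) n) (es : List (Fin n × Fin n)) →
  colourWeight c (Vec.fromList es) ≡
  -1ℤ ^ length es ℤ.* (1ℤ ℤ.- + q) ^ length (filter (monochromatic? c) es)
colourWeight-fromList c [] = refl
colourWeight-fromList {q = q} c ((u , v) ∷ es) with lookup c u Fin.≟ lookup c v
... | yes _ = trans (cong (ℤ._*_ (+ q ℤ.* 1ℤ ℤ.- 1ℤ)) (colourWeight-fromList c es))
                    (lemma (+ q) (-1ℤ ^ length es) ((1ℤ ℤ.- + q) ^ length (filter (monochromatic? c) es)))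
  where
  lemma : ∀ q a b → (q ℤ.* 1ℤ ℤ.- 1ℤ) ℤ.* (a ℤ.* b) ≡ -1ℤ ℤ.* a ℤ.* ((1ℤ ℤ.- q) ℤ.* b)
  lemma = solve-∀
... | no _  = trans (cong (ℤ._*_ (+ q ℤ.* 0ℤ ℤ.- 1ℤ)) (colourWeight-fromList c es))
                    (lemma (+ q) (-1ℤ ^ length es) ((1ℤ ℤ.- + q) ^ length (filter (monochromatic? c) es)))
  where
  lemma : ∀ q a b → (q ℤ.* 0ℤ ℤ.- 1ℤ) ℤ.* (a ℤ.* b) ≡ -1ℤ ℤ.* a ℤ.* b
  lemma = solve-∀

colourSum-complete : ∀ n q → colourSum {q = q} (Graph.edges (K n)) ≡
  -1ℤ ^ pairs n ℤ.* familySum n (1ℤ ℤ.- + q) (+ q) []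
colourSum-complete n q = begin
  ∑ cs (λ c → colourWeight c (Vec.fromList (completeEdges n)))
    ≡⟨ ∑-cong cs (λ c → trans (colourWeight-fromList c (completeEdges n))
         (cong₂ (λ k l → -1ℤ ^ k ℤ.* y ^ l) (length-completeEdges n) (s-classes c))) ⟩
  ∑ cs (λ c → -1ℤ ^ pairs n ℤ.* weight n y (toList (classes c)))
    ≡⟨ ∑-*ˡ cs (-1ℤ ^ pairs n) _ ⟩
  -1ℤ ^ pairs n ℤ.* ∑ cs (λ c → weight n y (toList (classes c)))
    ≡⟨ cong (ℤ._*_ (-1ℤ ^ pairs n)) (∑-classes q n (λ M → weight n y (toList M))) ⟨
  -1ℤ ^ pairs n ℤ.* tupleSum n y q []
    ≡⟨ cong (ℤ._*_ (-1ℤ ^ pairs n)) (tupleSum≡familySum n y q []) ⟩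
  -1ℤ ^ pairs n ℤ.* familySum n y (+ q) [] ∎
  where
  open ≡-Reasoning
  y = 1ℤ ℤ.- + q
  cs = words n (allFin q)

-- Set partitions by block sizes

∑-applyUpTo : (h : ℕ → A) (N : ℕ) (g : A → ℤ) → ∑ (applyUpTo h N) g ≡ ∑ (upTo N) (λ m → g (h m))
∑-applyUpTo h zero    g = refl
∑-applyUpTo h (suc N) g = cong (ℤ._+_ (g (h 0)))
  (trans (∑-applyUpTo (λ m → h (suc m)) N g) (sym (∑-applyUpTo suc N (λ m → g (h m)))))

∑-upTo-δ : ∀ k N → k ℕ.< N → ∑ (upTo N) (λ m → 𝟙 (k ℕ.≟ m)) ≡ 1ℤ
∑-upTo-δ zero    (suc N) _   =
  cong (ℤ._+_ 1ℤ) (trans (∑-applyUpTo suc N (λ m → 𝟙 (0 ℕ.≟ m))) (∑-0 (upTo N)))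
∑-upTo-δ (suc k) (suc N) k<N = begin
  0ℤ ℤ.+ ∑ (applyUpTo suc N) (λ m → 𝟙 (suc k ℕ.≟ m))   ≡⟨ ℤ.+-identityˡ _ ⟩
  ∑ (applyUpTo suc N) (λ m → 𝟙 (suc k ℕ.≟ m))          ≡⟨ ∑-applyUpTo suc N (λ m → 𝟙 (suc k ℕ.≟ m)) ⟩
  ∑ (upTo N) (λ m → 𝟙 (suc k ℕ.≟ suc m))               ≡⟨ ∑-cong (upTo N) (λ m → 𝟙-cong (suc k ℕ.≟ suc m) (k ℕ.≟ m) ℕ.suc-injective (cong suc)) ⟩
  ∑ (upTo N) (λ m → 𝟙 (k ℕ.≟ m))                       ≡⟨ ∑-upTo-δ k N (ℕ.s<s⁻¹ k<N) ⟩
  1ℤ                                                   ∎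
  where open ≡-Reasoning

∑-words-δ : ∀ {N} m {μ} → All (ℕ._< N) μ →
  ∑ (words m (upTo N)) (λ w → 𝟙 (≡-dec ℕ._≟_ μ (toList w))) ≡ 𝟙 (length μ ℕ.≟ m)
∑-words-δ     zero    []                   = refl
∑-words-δ     zero    (_ ∷ _)              = refl
∑-words-δ {N} (suc m) []                   =
  trans (∑-words-suc m (upTo N) _) (trans (∑-cong (upTo N) (λ _ → ∑-0 (words m (upTo N)))) (∑-0 (upTo N)))
∑-words-δ {N} (suc m) (_∷_ {k} {μ} k<N μ<N) = begin
  ∑ (words (suc m) (upTo N)) (λ w → 𝟙 (≡-dec ℕ._≟_ (k ∷ μ) (toList w)))
    ≡⟨ ∑-words-suc m (upTo N) _ ⟩
  ∑ (upTo N) (λ a → ∑ ws (λ w → 𝟙 (≡-dec ℕ._≟_ (k ∷ μ) (a ∷ toList w))))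
    ≡⟨ ∑-cong (upTo N) (λ a → trans (∑-cong ws (λ w → trans
         (𝟙-cong (≡-dec ℕ._≟_ (k ∷ μ) (a ∷ toList w)) (k ℕ.≟ a ×-dec ≡-dec ℕ._≟_ μ (toList w))
                 ∷-injective (uncurry (cong₂ _∷_)))
         (𝟙-× (k ℕ.≟ a) (≡-dec ℕ._≟_ μ (toList w)))))
         (trans (∑-*ˡ ws (𝟙 (k ℕ.≟ a)) _) (cong (ℤ._*_ (𝟙 (k ℕ.≟ a))) (∑-words-δ m μ<N)))) ⟩
  ∑ (upTo N) (λ a → 𝟙 (k ℕ.≟ a) ℤ.* 𝟙 (length μ ℕ.≟ m))
    ≡⟨ ∑-*ʳ (upTo N) (𝟙 (length μ ℕ.≟ m)) (λ a → 𝟙 (k ℕ.≟ a)) ⟩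
  ∑ (upTo N) (λ a → 𝟙 (k ℕ.≟ a)) ℤ.* 𝟙 (length μ ℕ.≟ m)
    ≡⟨ cong (ℤ._* 𝟙 (length μ ℕ.≟ m)) (∑-upTo-δ k N k<N) ⟩
  1ℤ ℤ.* 𝟙 (length μ ℕ.≟ m)
    ≡⟨ ℤ.*-identityˡ (𝟙 (length μ ℕ.≟ m)) ⟩
  𝟙 (length μ ℕ.≟ m)
    ≡⟨ 𝟙-cong (length μ ℕ.≟ m) (suc (length μ) ℕ.≟ suc m) (cong suc) ℕ.suc-injective ⟩
  𝟙 (suc (length μ) ℕ.≟ suc m) ∎
  where
  open ≡-Reasoning
  ws = words m (upTo N)

parts≤sum : ∀ μ → All (ℕ._≤ sum μ) μ
parts≤sum []      = []
parts≤sum (k ∷ μ) = ℕ.m≤m+n k (sum μ) ∷ All.map (λ l≤ → ℕ.≤-trans l≤ (ℕ.m≤n+m (sum μ) k)) (parts≤sum μ)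

length≤sum : ∀ {μ} → All (1 ℕ.≤_) μ → length μ ℕ.≤ sum μ
length≤sum []         = ℕ.z≤n
length≤sum (1≤k ∷ ks) = ℕ.+-mono-≤ 1≤k (length≤sum ks)

-- A partition `μ` of `n` is listed exactly once: its parts and its length are at most `sum μ`, so
-- they lie below the bound `suc n` of the enumeration.
∑-partitions-δ : ∀ {n μ} → IsPartition n μ → (g : List ℕ → ℤ) →
  ∑ (partitions n) (λ ν → 𝟙 (≡-dec ℕ._≟_ μ ν) ℤ.* g ν) ≡ g μ
∑-partitions-δ {n} {μ} isP@(_ , 1≤μ , refl) g = begin
  ∑ (partitions n) (λ ν → δμ ν ℤ.* g ν)
    ≡⟨ ∑-filter (isPartition? n) candidates _ ⟩
  ∑ candidates (λ ν → 𝟙 (isPartition? n ν) ℤ.* (δμ ν ℤ.* g ν))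
    -- The indicator selects ν = μ, where the test for being a partition succeeds, so the test
    -- disappears and `g ν` becomes constant.
    ≡⟨ ∑-cong candidates only-μ ⟩
  ∑ candidates (λ ν → δμ ν ℤ.* g μ)
    ≡⟨ ∑-*ʳ candidates (g μ) δμ ⟩
  ∑ candidates δμ ℤ.* g μ
    ≡⟨ cong (ℤ._* g μ) (begin
         ∑ candidates δμ
           ≡⟨ ∑-concatMap (λ m → map toList (words m (upTo (suc n)))) (upTo (suc n)) δμ ⟩
         ∑ (upTo (suc n)) (λ m → ∑ (map toList (words m (upTo (suc n)))) δμ)
           ≡⟨ ∑-cong (upTo (suc n)) (λ m → trans (∑-map toList (words m (upTo (suc n))) δμ)
                                                 (∑-words-δ m (All.map ℕ.s≤s (parts≤sum μ)))) ⟩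
         ∑ (upTo (suc n)) (λ m → 𝟙 (length μ ℕ.≟ m))
           ≡⟨ ∑-upTo-δ (length μ) (suc n) (ℕ.s≤s (length≤sum 1≤μ)) ⟩
         1ℤ ∎) ⟩
  1ℤ ℤ.* g μ
    ≡⟨ ℤ.*-identityˡ (g μ) ⟩
  g μ ∎
  where
  open ≡-Reasoning
  candidates : List (List ℕ)
  candidates = concatMap (λ m → map toList (words m (upTo (suc n)))) (upTo (suc n))
  δμ : List ℕ → ℤ
  δμ ν = 𝟙 (≡-dec ℕ._≟_ μ ν)
  only-μ : ∀ ν → 𝟙 (isPartition? n ν) ℤ.* (δμ ν ℤ.* g ν) ≡ δμ ν ℤ.* g μ
  only-μ ν with ≡-dec ℕ._≟_ μ ν
  ... | yes refl = trans (cong (ℤ._* (1ℤ ℤ.* g μ)) (𝟙-yes (isPartition? n μ) isP)) (ℤ.*-identityˡ (1ℤ ℤ.* g μ))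
  ... | no _     = ℤ.*-zeroʳ (𝟙 (isPartition? n ν))

∣∣-∑ : (B : Subset n) → + ∣ B ∣ ≡ ∑ (allFin n) (λ i → + coverage i (B ∷ []))
∣∣-∑ []           = refl
∣∣-∑ {suc n} (x ∷ B) = trans (head x) (sym (∑-allFin-suc n (λ i → + coverage i ((x ∷ B) ∷ []))))
  where
  tail : ∀ i → + coverage i (B ∷ []) ≡ + coverage (suc i) ((x ∷ B) ∷ [])
  tail i with i ∈? B
  ... | yes _ = refl
  ... | no _  = refl
  step : ∑ (allFin n) (λ i → + coverage i (B ∷ [])) ≡ ∑ (allFin n) (λ i → + coverage (suc i) ((x ∷ B) ∷ []))
  step = ∑-cong (allFin n) tail
  head : ∀ x′ → + ∣ x′ ∷ B ∣ ≡ + coverage zero ((x′ ∷ B) ∷ []) ℤ.+ ∑ (allFin n) (λ i → + coverage (suc i) ((x ∷ B) ∷ []))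
  head inside  = cong (ℤ._+_ 1ℤ) (trans (∣∣-∑ B) step)
  head outside = trans (trans (∣∣-∑ B) step) (sym (ℤ.+-identityˡ _))

-- Double counting of the pairs of a point and a block containing it.
sum-sizes : (π : List (Subset n)) → + sum (map ∣_∣ π) ≡ ∑ (allFin n) (λ i → + coverage i π)
sum-sizes {n} []      = sym (∑-0 (allFin n))
sum-sizes {n} (B ∷ π) = begin
  + ∣ B ∣ ℤ.+ + sum (map ∣_∣ π)
    ≡⟨ cong₂ ℤ._+_ (∣∣-∑ B) (sum-sizes π) ⟩
  ∑ (allFin n) (λ i → + coverage i (B ∷ [])) ℤ.+ ∑ (allFin n) (λ i → + coverage i π)
    ≡⟨ ∑-+ (allFin n) (λ i → + coverage i (B ∷ [])) (λ i → + coverage i π) ⟨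
  ∑ (allFin n) (λ i → + coverage i (B ∷ []) ℤ.+ + coverage i π)
    ≡⟨ ∑-cong (allFin n) (λ i → cong +_ (sym (coverage-∷ i B π))) ⟩
  ∑ (allFin n) (λ i → + coverage i (B ∷ π)) ∎
  where open ≡-Reasoning

blockSizes : List (Subset n) → List ℕ
blockSizes π = sort (map ∣_∣ π)

blockSizes-isPartition : {π : List (Subset n)} → IsDivision π → IsPartition n (blockSizes π)
blockSizes-isPartition {n} {π} (nonempty , once) =
  sort-↗ (map ∣_∣ π) ,
  All-resp-↭ (↭-sym (sort-↭ (map ∣_∣ π)))
    -- A block is strictly larger than the same block without its element `i`, hence its size is
    -- positive.
    (All.map⁺ (All.map (λ (i , i∈B) → ℕ.≤-trans (ℕ.s≤s ℕ.z≤n) (x∈p⇒∣p-x∣<∣p∣ i∈B)) nonempty)) ,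
  trans (sum-↭ (sort-↭ (map ∣_∣ π))) (ℤ.+-injective (begin
    + sum (map ∣_∣ π)                        ≡⟨ sum-sizes π ⟩
    ∑ (allFin n) (λ i → + coverage i π)      ≡⟨ ∑-cong (allFin n) (λ i → cong +_ (once i)) ⟩
    ∑ (allFin n) (λ _ → 1ℤ)                  ≡⟨ ∑-allFin-const n 1ℤ ⟩
    + n ℤ.* 1ℤ                               ≡⟨ ℤ.*-identityʳ (+ n) ⟩
    + n                                      ∎))
  where open ≡-Reasoning

-- Since `g` is symmetric it may be evaluated at the sorted sizes, which form a partition. Each
-- division is then expanded as a sum over all μ with an indicator, and after exchanging the sums
-- the indicators of a fixed μ add up to `f n μ`.
∑-divisions-by-type : ∀ n (g : List ℕ → ℤ) → (∀ {μ ν} → μ ↭ ν → g μ ≡ g ν) →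
  ∑ (divisions n) (λ π → g (map ∣_∣ π)) ≡ ∑ (partitions n) (λ μ → + f n μ ℤ.* g μ)
∑-divisions-by-type n g g-resp-↭ = begin
  ∑ (divisions n) (λ π → g (map ∣_∣ π))
    ≡⟨ ∑-congᴬ (All.map (λ {π} isD → trans (g-resp-↭ (↭-sym (sort-↭ (map ∣_∣ π))))
                                           (sym (∑-partitions-δ (blockSizes-isPartition isD) g)))
                        (All.all-filter isDivision? (sublists (subsets n)))) ⟩
  ∑ (divisions n) (λ π → ∑ (partitions n) (λ μ → 𝟙 (≡-dec ℕ._≟_ (blockSizes π) μ) ℤ.* g μ))
    ≡⟨ ∑-swap (divisions n) (partitions n) _ ⟩
  ∑ (partitions n) (λ μ → ∑ (divisions n) (λ π → 𝟙 (≡-dec ℕ._≟_ (blockSizes π) μ) ℤ.* g μ))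
    ≡⟨ ∑-cong (partitions n) (λ μ → trans
         (∑-*ʳ (divisions n) (g μ) (λ π → 𝟙 (≡-dec ℕ._≟_ (blockSizes π) μ)))
         (cong (ℤ._* g μ) (sym (length-filter-∑ (λ π → ≡-dec ℕ._≟_ (blockSizes π) μ) (divisions n))))) ⟩
  ∑ (partitions n) (λ μ → + f n μ ℤ.* g μ) ∎
  where open ≡-Reasoning

familySum-[] : ∀ n x y → familySum n y x [] ≡
  ∑ (partitions n) (λ μ → + f n μ ℤ.* (y ^ s μ ℤ.* falling x (length μ)))
familySum-[] n x y = begin
  ∑ (sublists (subsets n)) (λ π → falling x (length π) ℤ.* mass n y [] π)
    ≡⟨ ∑-cong (sublists (subsets n)) (λ π → trans
         (lemma (falling x (length π)) (𝟙 (All.all? nonempty? π)) (𝟙 (complementary? [] π)) (weight n y π))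
         (cong₂ (λ d k → d ℤ.* (weight n y π ℤ.* falling x k))
                -- `coverage i []` computes to 0, so for empty σ the two tests together are
                -- `isDivision?`.
                (sym (𝟙-× (All.all? nonempty? π) (complementary? [] π)))
                (sym (length-map ∣_∣ π)))) ⟩
  ∑ (sublists (subsets n)) (λ π → 𝟙 (isDivision? π) ℤ.* g (map ∣_∣ π))
    ≡⟨ ∑-filter isDivision? (sublists (subsets n)) (λ π → g (map ∣_∣ π)) ⟨
  ∑ (divisions n) (λ π → g (map ∣_∣ π))
    ≡⟨ ∑-divisions-by-type n g (λ p → cong₂ (λ k l → y ^ k ℤ.* falling x l) (sum-↭ (↭-map⁺ pairs p)) (↭-length p)) ⟩
  ∑ (partitions n) (λ μ → + f n μ ℤ.* g μ) ∎
  where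
  open ≡-Reasoning
  g : List ℕ → ℤ
  g μ = y ^ s μ ℤ.* falling x (length μ)
  lemma : ∀ a b c d → a ℤ.* (b ℤ.* (c ℤ.* d)) ≡ b ℤ.* c ℤ.* (d ℤ.* a)
  lemma = solve-∀

-- Evaluation of the right-hand side and the identity of polynomials

eval-fallingFactorial : ∀ k x → eval (fallingFactorial k) x ≡ falling x k
eval-fallingFactorial zero    x = eval-const 1ℤ x
eval-fallingFactorial (suc k) x =
  trans (eval-⊗ (fallingFactorial k) (X ⊖ const (+ k)) x)
        (cong₂ ℤ._*_ (eval-fallingFactorial k x)
                    (trans (eval-⊖ X (const (+ k)) x) (cong₂ ℤ._-_ (eval-X x) (eval-const (+ k) x))))

eval-sumᵖ : ∀ {A : Set} (p : A → Poly) (xs : List A) x →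
  eval (sumᵖ (map p xs)) x ≡ ∑ xs (λ a → eval (p a) x)
eval-sumᵖ p []       x = refl
eval-sumᵖ p (a ∷ as) x = trans (eval-⊕ (p a) _ x) (cong (ℤ._+_ (eval (p a) x)) (eval-sumᵖ p as x))

theorem3 : (n : ℕ) → .{{_ : NonZero n}} →
    ∃ (IsFlowPolynomial (K n)) ×
    (∀ F → IsFlowPolynomial (K n) F →
    X ^ᵖ n ⊗ F
    ≈ const (-1ℤ ^ ((n * (n ∸ 1)) / 2))
    ⊗ sumᵖ (map (λ μ → const (+ f n μ)
    ⊗ (const 1ℤ ⊖ X) ^ᵖ s μ
    ⊗ fallingFactorial (length μ))
    (partitions n)))
theorem3 n = (flowPoly (Graph.edges (K n)) , flowPoly-isFlowPolynomial (K n)) , λ F isFlow →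
  eval-injective (X ^ᵖ n ⊗ F) (const (-1ℤ ^ pairs n) ⊗ sumᵖ (map term (partitions n)))
                 (λ r → values F isFlow r)
  where
  open ≡-Reasoning
  term : List ℕ → Poly
  term μ = const (+ f n μ) ⊗ (const 1ℤ ⊖ X) ^ᵖ s μ ⊗ fallingFactorial (length μ)

  eval-term : ∀ x μ →
    eval (term μ) x ≡ + f n μ ℤ.* ((1ℤ ℤ.- x) ^ s μ ℤ.* falling x (length μ))
  eval-term x μ = begin
    eval (term μ) x
      ≡⟨ eval-⊗ (const (+ f n μ) ⊗ (const 1ℤ ⊖ X) ^ᵖ s μ) (fallingFactorial (length μ)) x ⟩
    eval (const (+ f n μ) ⊗ (const 1ℤ ⊖ X) ^ᵖ s μ) x ℤ.* eval (fallingFactorial (length μ)) x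
      ≡⟨ cong₂ ℤ._*_
           (trans (eval-⊗ (const (+ f n μ)) ((const 1ℤ ⊖ X) ^ᵖ s μ) x)
                  (cong₂ ℤ._*_ (eval-const (+ f n μ) x)
                    (trans (eval-^ (const 1ℤ ⊖ X) (s μ) x)
                           (cong (_^ s μ) (trans (eval-⊖ (const 1ℤ) X x)
                                                 (cong₂ ℤ._-_ (eval-const 1ℤ x) (eval-X x)))))))
           (eval-fallingFactorial (length μ) x) ⟩
    + f n μ ℤ.* (1ℤ ℤ.- x) ^ s μ ℤ.* falling x (length μ)
      ≡⟨ ℤ.*-assoc (+ f n μ) ((1ℤ ℤ.- x) ^ s μ) (falling x (length μ)) ⟩
    + f n μ ℤ.* ((1ℤ ℤ.- x) ^ s μ ℤ.* falling x (length μ)) ∎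

  values : ∀ F → IsFlowPolynomial (K n) F → ∀ r →
    eval (X ^ᵖ n ⊗ F) (+ suc r) ≡ eval (const (-1ℤ ^ pairs n) ⊗ sumᵖ (map term (partitions n))) (+ suc r)
  values F isFlow r = begin
    eval (X ^ᵖ n ⊗ F) x
      ≡⟨ eval-⊗ (X ^ᵖ n) F x ⟩
    eval (X ^ᵖ n) x ℤ.* eval F x
      ≡⟨ cong₂ ℤ._*_ (trans (eval-^ X n x) (cong (_^ n) (eval-X x)))
                    -- The listed edges serve as their own orientation.
                    (isFlow edges (Pointwise.refl (inj₁ refl)) (suc r)) ⟩
    x ^ n ℤ.* + flowCount edges (suc r)
      ≡⟨ flowCount-colourSum edges r ⟩
    colourSum edges
      ≡⟨ colourSum-complete n (suc r) ⟩
    -1ℤ ^ pairs n ℤ.* familySum n (1ℤ ℤ.- x) x []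
      ≡⟨ cong (ℤ._*_ (-1ℤ ^ pairs n)) (begin
           familySum n (1ℤ ℤ.- x) x []
             ≡⟨ familySum-[] n x (1ℤ ℤ.- x) ⟩
           ∑ (partitions n) (λ μ → + f n μ ℤ.* ((1ℤ ℤ.- x) ^ s μ ℤ.* falling x (length μ)))
             ≡⟨ ∑-cong (partitions n) (λ μ → sym (eval-term x μ)) ⟩
           ∑ (partitions n) (λ μ → eval (term μ) x)
             ≡⟨ eval-sumᵖ term (partitions n) x ⟨
           eval (sumᵖ (map term (partitions n))) x ∎) ⟩
    -1ℤ ^ pairs n ℤ.* eval (sumᵖ (map term (partitions n))) x
      ≡⟨ cong (ℤ._* eval (sumᵖ (map term (partitions n))) x) (eval-const (-1ℤ ^ pairs n) x) ⟨
    eval (const (-1ℤ ^ pairs n)) x ℤ.* eval (sumᵖ (map term (partitions n))) x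
      ≡⟨ eval-⊗ (const (-1ℤ ^ pairs n)) (sumᵖ (map term (partitions n))) x ⟨
    eval (const (-1ℤ ^ pairs n) ⊗ sumᵖ (map term (partitions n))) x ∎
    where
    x = + suc r
    edges = Graph.edges (K n)
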